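{- Let $q=p^m$ with $p$ prime, let $T,\theta$ be functions such that $G=\{\mathfrak{g}_{a,b,c}\}$ is closed under $\circ$ and some $\theta_{a,b,c}$ is nontrivial, and let $g_2\in\mathrm{Aut}(\mathbb{F}_q)$ have order $p$. If $r_A\le1$, then there exists $\mu_A\in\mathbb{F}_q$ with $g_2(\mu_A)=\mu_A$ and $\theta_{x,0,0}=g_2^{\mathrm{tr}_{\mathbb{F}_q/\mathbb{F}_p}(\mu_Ax)}$ for all $x\in\mathbb{F}_q$. Likewise, if $r_B\le1$, there exists $\mu_B\in\mathbb{F}_q$ with $g_2(\mu_B)=\mu_B$ and $\theta_{0,x,0}=g_2^{\mathrm{tr}_{\mathbb{F}_q/\mathbb{F}_p}(\mu_Bx)}$ for all $x\in\mathbb{F}_q$.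
   Context: $T:\mathbb{F}_q^3\to\mathbb{F}_q$, $\theta:\mathbb{F}_q^3\to\mathrm{Aut}(\mathbb{F}_q)$, $\theta_{a,b,c}=\theta(a,b,c)$. $E(a,b,c,t)$ is the matrix with rows $(1,0,0,0),(-c,1,0,0),(b-ct,t,1,0),(a,b,c,1)$; $\mathfrak{g}_{a,b,c}=(E(a,b,c,T(a,b,c)),\theta_{a,b,c})$ with product $(A_1,\sigma_1)\circ(A_2,\sigma_2)=(A_1^{\sigma_2}A_2,\sigma_1\sigma_2)$; $G=\{\mathfrak{g}_{a,b,c}\}$. $\psi:\mathfrak{g}_{a,b,c}\mapsto\theta_{a,b,c}$. $p^{r_A}$ (resp. $p^{r_B}$) is the exponent of $\psi(G_A)$ (resp. $\psi(G_B)$), where $G_A=\{\mathfrak{g}_{a,0,0}\}$, $G_B=\{\mathfrak{g}_{0,b,0}\}$. $\mathrm{tr}_{\mathbb{F}_q/\mathbb{F}_p}(x)=\sum_{i=0}^{m-1}x^{p^i}$. -}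

module Defs where

open import Level using (0ℓ)
open import Data.Nat as ℕ using (ℕ; zero; suc; _≤_; _<_)
open import Data.Nat.Primality using (Prime)
open import Data.Fin using (Fin; zero; suc)
open import Data.Product using (Σ; _×_; _,_; ∃; ∃-syntax)
open import Function using (_∘_; id)
open import Function.Bundles using (_↔_)
open import Relation.Binary.PropositionalEquality using (_≡_; _≢_)
open import Relation.Nullary using (¬_)
open import Algebra.Structures using (IsCommutativeRing)

record FiniteField (p m : ℕ) : Set₁ where
  field
    Carrier : Set
    _+_ _*_ : Carrier → Carrier → Carrier
    -_      : Carrier → Carrier
    0# 1#   : Carrier
    isCommutativeRing : IsCommutativeRing _≡_ _+_ _*_ -_ 0# 1#
    0≢1     : 0# ≢ 1#
    _⁻¹     : Carrier → Carrier
    ⁻¹-inverse : ∀ x → x ≢ 0# → x * (x ⁻¹) ≡ 1#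
    prime   : Prime p
    m≥1     : 1 ≤ m
    enum    : Fin (p ℕ.^ m) ↔ Carrier

  infixl 6 _+_
  infixl 7 _*_

  pow : Carrier → ℕ → Carrier
  pow x zero    = 1#
  pow x (suc n) = x * pow x n

  natMul1 : ℕ → Carrier
  natMul1 zero    = 0#
  natMul1 (suc n) = 1# + natMul1 n

  trace : Carrier → Carrier
  trace x = go m
    where
    go : ℕ → Carrier
    go zero    = 0#
    go (suc i) = pow x (p ℕ.^ i) + go i

  record Aut : Set where
    field
      fun     : Carrier → Carrier
      inv     : Carrier → Carrier
      inv-l   : ∀ x → inv (fun x) ≡ x
      inv-r   : ∀ x → fun (inv x) ≡ x
      hom-+   : ∀ x y → fun (x + y) ≡ fun x + fun y
      hom-*   : ∀ x y → fun (x * y) ≡ fun x * fun y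
      hom-1   : fun 1# ≡ 1#
  open Aut public

  _≈ᴬ_ : Aut → Aut → Set
  σ ≈ᴬ τ = ∀ x → fun σ x ≡ fun τ x

  IsId : Aut → Set
  IsId σ = ∀ x → fun σ x ≡ x

  iter : Aut → ℕ → Carrier → Carrier
  iter σ zero    x = x
  iter σ (suc n) x = fun σ (iter σ n x)

  PowId : Aut → ℕ → Set
  PowId σ n = ∀ x → iter σ n x ≡ x

  HasOrder : Aut → ℕ → Set
  HasOrder σ n = 1 ≤ n × PowId σ n × (∀ k → 1 ≤ k → k < n → ¬ PowId σ k)

  IsExponent : {I : Set} → (I → Aut) → ℕ → Set
  IsExponent {I} f e =
    1 ≤ e × (∀ i → PowId (f i) e) × (∀ k → 1 ≤ k → (∀ i → PowId (f i) k) → e ≤ k)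

  Mat : Set
  Mat = Fin 4 → Fin 4 → Carrier

  sum4 : (Fin 4 → Carrier) → Carrier
  sum4 f = f zero + (f (suc zero) + (f (suc (suc zero)) + f (suc (suc (suc zero)))))

  infixl 7 _⊗_
  infix 8 _^ᴬ_
  infix 4 _≈ᴹ_
  _⊗_ : Mat → Mat → Mat
  (A ⊗ B) i j = sum4 (λ k → A i k * B k j)

  _^ᴬ_ : Mat → Aut → Mat
  (A ^ᴬ σ) i j = fun σ (A i j)

  E : Carrier → Carrier → Carrier → Carrier → Mat
  E a b c t zero                   zero                   = 1#
  E a b c t zero                   _                      = 0#
  E a b c t (suc zero)             zero                   = - c
  E a b c t (suc zero)             (suc zero)             = 1#
  E a b c t (suc zero)             _                      = 0#
  E a b c t (suc (suc zero))       zero                   = b + - (c * t)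
  E a b c t (suc (suc zero))       (suc zero)             = t
  E a b c t (suc (suc zero))       (suc (suc zero))       = 1#
  E a b c t (suc (suc zero))       _                      = 0#
  E a b c t (suc (suc (suc zero))) zero                   = a
  E a b c t (suc (suc (suc zero))) (suc zero)             = b
  E a b c t (suc (suc (suc zero))) (suc (suc zero))       = c
  E a b c t (suc (suc (suc zero))) (suc (suc (suc zero))) = 1#

  _≈ᴹ_ : Mat → Mat → Set
  A ≈ᴹ B = ∀ i j → A i j ≡ B i j

  -- The set G = {g_{a,b,c}}, g_{a,b,c} = (E(a,b,c,T(a,b,c)), θ_{a,b,c}),
  -- with (A₁,σ₁)∘(A₂,σ₂) = (A₁^{σ₂} A₂, σ₁σ₂), where σ₁σ₂ is the
  -- automorphism x ↦ (x^{σ₁})^{σ₂} (Aut(F_q) is abelian, so the order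
  -- is immaterial).

  Tfun : Set
  Tfun = Carrier → Carrier → Carrier → Carrier

  Θfun : Set
  Θfun = Carrier → Carrier → Carrier → Aut

  gMat : Tfun → Carrier → Carrier → Carrier → Mat
  gMat T a b c = E a b c (T a b c)

  Closed : Tfun → Θfun → Set
  Closed T θ = ∀ a b c a' b' c' → ∃[ a'' ] ∃[ b'' ] ∃[ c'' ]
    ( gMat T a'' b'' c'' ≈ᴹ (gMat T a b c ^ᴬ θ a' b' c') ⊗ gMat T a' b' c'
    × (∀ x → fun (θ a'' b'' c'') x ≡ fun (θ a' b' c') (fun (θ a b c) x)) )

  SomeNontrivial : Θfun → Set
  SomeNontrivial θ = ∃[ a ] ∃[ b ] ∃[ c ] ¬ IsId (θ a b c)

  ψGA : Θfun → Carrier → Aut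
  ψGA θ a = θ a 0# 0#

  ψGB : Θfun → Carrier → Aut
  ψGB θ b = θ 0# b 0#

  -- σ = g^{t} for t ∈ F_p ⊆ F_q: t = k·1 for some k ∈ ℕ and σ = g^k.
  -- (As g has order p = char F_q, g^k depends only on k·1.)
  IsPowByPrimeField : Aut → Aut → Carrier → Set
  IsPowByPrimeField σ g t = ∃[ k ] (natMul1 k ≡ t × (∀ x → fun σ x ≡ iter g k x))

{-# OPTIONS --safe #-}
module Submission where

-- Restricted to x ↦ g_{x,0,0}, or x ↦ g_{0,x,0}, closure of G says f (f(y) x + y) = f(x) f(y)
-- for f = θ, i.e. f is a homomorphism for the twisted law x ∘ y = f(y) x + y.
--
-- By pigeonhole on a spanning family of at most m elements, every additive map F → F is
-- Σ a_j x^(p^j) with j < m, uniquely because such a polynomial has fewer than q roots.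
-- Hence every automorphism is a power of Frobenius, Aut(F) is cyclic, and f(x) = g^κ(x).
--
-- Let k(x) be κ(x)·1 ∈ F_p and K its zero set. Its fibres are the cosets of the additive group
-- K, so F/K is at most a line over F_p; g acts on it by a scalar n with n = n^p = 1. So k is
-- g-invariant, which makes it additive, k(x) = Σ a_j x^(p^j). Comparing coefficients in k^p = k
-- gives a_j = a_0^(p^j), i.e. k(x) = tr(a_0 x), and in g ∘ k = k ∘ g it gives g(a_0) = a_0.

open import Defs
open import Level using (0ℓ)
open import Algebra.Bundles using (CommutativeRing)
open import Data.Nat as ℕ using (ℕ; zero; suc; _≤_; _<_; _^_; z≤n; s≤s; NonZero)
import Data.Nat.Properties as ℕₚ
open import Data.Nat.Divisibility using (_∣_; _∣?_; divides; ∣⇒≤; m%n≡0⇒n∣m)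
open import Data.Nat.Primality using (Prime; prime⇒irreducible; prime⇒nonZero; prime⇒nonTrivial; euclidsLemma)
open import Data.Nat.Coprimality using (Coprime; coprime-Bézout; coprime-divisor) renaming (sym to Coprime-sym)
open import Data.Nat.GCD using (module Bézout)
open import Data.Nat.Combinatorics using (_C_; nCn≡1; nC1≡n; nCk+nC[k+1]≡[n+1]C[k+1])
open import Data.Nat.DivMod using (_%_; _/_; m≡m%n+[m/n]*n; m%n<n)
open import Data.Nat.Solver using (module +-*-Solver)
open import Data.Fin as Fin using (Fin; zero; suc; toℕ; #_)
import Data.Fin.Properties as Finₚ
open import Data.Fin.Permutation using (Permutation′; permutation)
open import Data.Vec using (Vec; []; _∷_; zipWith)
open import Data.Product using (_×_; _,_; ∃; ∃-syntax; ∃₂; proj₁; proj₂)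
open import Data.Sum using (inj₁; inj₂)
open import Function using (_∘_)
open import Function.Bundles using (Inverse)
open import Function.Properties.Inverse using (↔⇒↣)
open import Function.Construct.Symmetry using (↔-sym)
open import Relation.Binary using (tri<; tri≈; tri>)
open import Relation.Nullary using (¬_; ¬?; Dec; yes; no)
open import Relation.Nullary.Decidable using (via-injection)
open import Relation.Nullary.Negation using (contradiction)
open import Relation.Binary.PropositionalEquality

-- The obstacle is the twist: k turns f(y) x + y into a sum, whereas a trace requires plain
-- additivity. The two laws agree as soon as y lies in K, because f(y) is then the identity. This
-- makes K an additive subgroup and reduces everything to k(g x) = k(x). If k is not identically
-- zero, say k(x₀) ≠ 0, then g is a power of f(x₀). K is the kernel of a homomorphism for the
-- twisted law, hence stable under every f(y), and therefore under g. The bound on the exponent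
-- enters through f(x)^p = 1: it places f(x) in the only subgroup of order p of the cyclic group
-- Aut(F), which g generates. The field is known only through its axioms and an enumeration, so the
-- facts about Aut(F), including x^q = x, all come from comparing coefficients of linearised
-- polynomials, which in turn rests on counting roots.

-- Inverses modulo a prime and p-torsion in ℤ/m

prime∤⇒coprime : ∀ {p a} → Prime p → ¬ p ∣ a → Coprime p a
prime∤⇒coprime pr p∤a (d∣p , d∣a) with prime⇒irreducible pr d∣p
... | inj₁ d≡1  = d≡1
... | inj₂ refl = contradiction d∣a p∤a

inverse-mod-prime : ∀ {p a} → Prime p → ¬ p ∣ a → ∃₂ λ e c → e ℕ.* a ≡ 1 ℕ.+ c ℕ.* p
inverse-mod-prime {zero} pr p∤a = contradiction (prime⇒nonZero pr) λ ()
inverse-mod-prime {suc zero} pr p∤a = contradiction (prime⇒nonTrivial pr) λ ()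
inverse-mod-prime {suc (suc q)} {a} pr p∤a with coprime-Bézout (prime∤⇒coprime pr p∤a)
... | Bézout.-+ x y eq = y , x , sym eq
... | Bézout.+- zero y ()
-- Here 1 + y a is a multiple of p, so -y inverts a; `suc q`, which is p - 1, stands for -1.
... | Bézout.+- (suc x) y eq =
  suc q ℕ.* y , q ℕ.+ x ℕ.* suc q , ℕₚ.+-cancelˡ-≡ (suc q) _ _ (begin
    suc q ℕ.+ suc q ℕ.* y ℕ.* a          ≡⟨ solve 3 (λ q y a → (con 1 :+ q) :+ (con 1 :+ q) :* y :* a := (con 1 :+ q) :* (con 1 :+ y :* a)) refl q y a ⟩
    suc q ℕ.* (1 ℕ.+ y ℕ.* a)            ≡⟨ cong (suc q ℕ.*_) eq ⟩
    suc q ℕ.* (suc x ℕ.* suc (suc q))     ≡⟨ solve 2 (λ q x → (con 1 :+ q) :* ((con 1 :+ x) :* (con 2 :+ q)) := (con 1 :+ q) :+ (con 1 :+ (q :+ x :* (con 1 :+ q)) :* (con 2 :+ q))) refl q x ⟩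
    suc q ℕ.+ (1 ℕ.+ (q ℕ.+ x ℕ.* suc q) ℕ.* suc (suc q)) ∎)
  where
  open ≡-Reasoning
  open +-*-Solver

cofactor : ∀ {p m m₁ i} .{{_ : NonZero p}} → m ≡ m₁ ℕ.* p → m ∣ p ℕ.* i → ∃ λ i′ → i ≡ i′ ℕ.* m₁
cofactor {p} {m} {m₁} {i} m≡ (divides c eq) = c , ℕₚ.*-cancelˡ-≡ _ _ p (begin
  p ℕ.* i            ≡⟨ eq ⟩
  c ℕ.* m            ≡⟨ cong (c ℕ.*_) m≡ ⟩
  c ℕ.* (m₁ ℕ.* p)   ≡⟨ ℕₚ.*-assoc c m₁ p ⟨
  c ℕ.* m₁ ℕ.* p     ≡⟨ ℕₚ.*-comm _ p ⟩
  p ℕ.* (c ℕ.* m₁)   ∎)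
  where open ≡-Reasoning

-- In ℤ/m the elements killed by the prime p are the multiples of any nonzero one.
p-torsion-cyclic : ∀ {p m i j} → Prime p → m ∣ p ℕ.* j → ¬ m ∣ j → m ∣ p ℕ.* i →
                   ∃₂ λ k c → k ℕ.* j ≡ i ℕ.+ c ℕ.* m
p-torsion-cyclic {p} {m} {i} {j} pr m∣pj m∤j m∣pi with p ∣? m
... | no p∤m = contradiction (coprime-divisor (Coprime-sym (prime∤⇒coprime pr p∤m)) m∣pj) m∤j
... | yes (divides m₁ m≡) with cofactor {{prime⇒nonZero pr}} m≡ m∣pj | cofactor {{prime⇒nonZero pr}} m≡ m∣pi
...   | j′ , j≡ | i′ , i≡ with inverse-mod-prime pr p∤j′
  where
  p∤j′ : ¬ p ∣ j′
  p∤j′ (divides c j′≡) = m∤j (divides c (begin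
    j                  ≡⟨ j≡ ⟩
    j′ ℕ.* m₁          ≡⟨ cong (ℕ._* m₁) j′≡ ⟩
    c ℕ.* p ℕ.* m₁     ≡⟨ ℕₚ.*-assoc c p m₁ ⟩
    c ℕ.* (p ℕ.* m₁)   ≡⟨ cong (c ℕ.*_) (trans (ℕₚ.*-comm p m₁) (sym m≡)) ⟩
    c ℕ.* m            ∎))
    where open ≡-Reasoning
-- Dividing out `m₁` leaves k j′ ≡ i′ modulo p, solved by k = i′ e; multiplying back by `m₁` turns
-- the modulus p into m.
...     | e , c , e*j′≡ = i′ ℕ.* e , i′ ℕ.* c , (begin
  i′ ℕ.* e ℕ.* j                        ≡⟨ cong (i′ ℕ.* e ℕ.*_) j≡ ⟩
  i′ ℕ.* e ℕ.* (j′ ℕ.* m₁)              ≡⟨ solve 4 (λ i e j m → i :* e :* (j :* m) := i :* (e :* j) :* m) refl i′ e j′ m₁ ⟩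
  i′ ℕ.* (e ℕ.* j′) ℕ.* m₁              ≡⟨ cong (λ n → i′ ℕ.* n ℕ.* m₁) e*j′≡ ⟩
  i′ ℕ.* (1 ℕ.+ c ℕ.* p) ℕ.* m₁         ≡⟨ solve 4 (λ i c p m → i :* (con 1 :+ c :* p) :* m := i :* m :+ i :* c :* (m :* p)) refl i′ c p m₁ ⟩
  i′ ℕ.* m₁ ℕ.+ i′ ℕ.* c ℕ.* (m₁ ℕ.* p) ≡⟨ cong₂ (λ u v → u ℕ.+ i′ ℕ.* c ℕ.* v) i≡ m≡ ⟨
  i ℕ.+ i′ ℕ.* c ℕ.* m                  ∎)
  where
  open ≡-Reasoning
  open +-*-Solver

-- Divisibility of binomial coefficients by a prime

-- The absorption identity, by induction through Pascal's rule; it exhibits the factor n + 1 without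
-- factorials.
[1+k]*[1+n]C[1+k] : ∀ n k → suc k ℕ.* (suc n C suc k) ≡ suc n ℕ.* (n C k)
[1+k]*[1+n]C[1+k] n zero = begin
  1 ℕ.* (suc n C 1)       ≡⟨ ℕₚ.*-identityˡ _ ⟩
  suc n C 1               ≡⟨ nC1≡n (suc n) ⟩
  suc n                   ≡⟨ ℕₚ.*-identityʳ _ ⟨
  suc n ℕ.* 1             ≡⟨⟩
  suc n ℕ.* (n C 0)       ∎
  where open ≡-Reasoning
[1+k]*[1+n]C[1+k] zero (suc k) = ℕₚ.*-zeroʳ (suc (suc k))
[1+k]*[1+n]C[1+k] (suc n) (suc k) = begin
  suc (suc k) ℕ.* (suc (suc n) C suc (suc k))
    ≡⟨ cong (suc (suc k) ℕ.*_) (nCk+nC[k+1]≡[n+1]C[k+1] (suc n) (suc k)) ⟨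
  suc (suc k) ℕ.* (c ℕ.+ (suc n C suc (suc k)))
    ≡⟨ ℕₚ.*-distribˡ-+ (suc (suc k)) c _ ⟩
  suc (suc k) ℕ.* c ℕ.+ suc (suc k) ℕ.* (suc n C suc (suc k))
    ≡⟨ cong₂ (λ u v → c ℕ.+ u ℕ.+ v) ([1+k]*[1+n]C[1+k] n k) ([1+k]*[1+n]C[1+k] n (suc k)) ⟩
  c ℕ.+ suc n ℕ.* (n C k) ℕ.+ suc n ℕ.* (n C suc k)
    ≡⟨ trans (ℕₚ.+-assoc c _ _) (cong (c ℕ.+_) (sym (ℕₚ.*-distribˡ-+ (suc n) (n C k) _))) ⟩
  c ℕ.+ suc n ℕ.* ((n C k) ℕ.+ (n C suc k))
    ≡⟨ cong (λ u → c ℕ.+ suc n ℕ.* u) (nCk+nC[k+1]≡[n+1]C[k+1] n k) ⟩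
  suc (suc n) ℕ.* c ∎
  where
  open ≡-Reasoning
  c = suc n C suc k

-- By absorption the prime divides (k + 1) times the coefficient, and k + 1 is too small to be a
-- multiple of it.
prime∣nCk : ∀ {n k} → Prime (suc n) → k < n → suc n ∣ suc n C suc k
prime∣nCk {n} {k} pr k<n
  with euclidsLemma (suc k) (suc n C suc k) pr
         (divides (n C k) (trans ([1+k]*[1+n]C[1+k] n k) (ℕₚ.*-comm (suc n) (n C k))))
... | inj₁ n∣k = contradiction (∣⇒≤ n∣k) (ℕₚ.<⇒≱ (s≤s k<n))
... | inj₂ n∣C = n∣C

-- The trace as an explicit sum

module _ {p m : ℕ} (F : FiniteField p m) where
  open FiniteField F

  traceSum : ℕ → Carrier → Carrier
  traceSum zero    x = 0#
  traceSum (suc n) x = pow x (p ℕ.^ n) + traceSum n x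

  -- Stated for any sequence with this recursion, so that it applies to the anonymous loop of
  -- `trace`, which satisfies the recursion by `refl`.
  traceSum-unique : ∀ x (t : ℕ → Carrier) → t 0 ≡ 0# → (∀ i → t (suc i) ≡ pow x (p ℕ.^ i) + t i) →
                    ∀ n → t n ≡ traceSum n x
  traceSum-unique x t base step zero    = base
  traceSum-unique x t base step (suc n) =
    trans (step n) (cong (pow x (p ℕ.^ n) +_) (traceSum-unique x t base step n))

-- The recursion inside trace is a local definition of Defs and cannot be named: traceLoop is
-- found by unification, which needs its argument n to be distinct from the exponent m of F.
mutual
  traceLoop : ∀ {p m} (F : FiniteField p m) → FiniteField.Carrier F → ℕ → FiniteField.Carrier F
  traceLoop = _

  trace≡traceSum : ∀ {p m} (F : FiniteField p m) x → FiniteField.trace F x ≡ traceSum F m x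
  trace≡traceSum {m = zero}  F x = refl
  trace≡traceSum {m = suc n} F x with suc n | F | x
  ... | m | F | x = cong (FiniteField._+_ F _)
    (traceSum-unique F x (traceLoop F x) refl (λ _ → refl) n)

-- Ring and field identities

module _ {p m : ℕ} (F : FiniteField p m) where
  open FiniteField F

  private instance
    p≢0 : NonZero p
    p≢0 = prime⇒nonZero prime

  ring : CommutativeRing 0ℓ 0ℓ
  ring = record { isCommutativeRing = isCommutativeRing }

  open CommutativeRing ring using
    ( +-assoc; +-comm; +-identityˡ; +-identityʳ; -‿inverseˡ; -‿inverseʳ
    ; *-assoc; *-comm; *-identityˡ; *-identityʳ; distribˡ; distribʳ; zeroˡ; zeroʳ
    ; commutativeSemiring; semiring; +-commutativeMonoid; +-commutativeSemigroup; *-commutativeSemigroup)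
  open import Algebra.Properties.Ring (CommutativeRing.ring ring) using (-‿distribˡ-*; -‿distribʳ-*; -0#≈0#; -‿+-comm; -‿involutive; +-cancelˡ; +-cancelʳ)
  open import Algebra.Properties.CommutativeSemigroup +-commutativeSemigroup using () renaming (interchange to +-interchange)
  open import Algebra.Properties.CommutativeSemigroup *-commutativeSemigroup using () renaming (interchange to *-interchange; x∙yz≈y∙xz to *-swap)
  open import Algebra.Properties.CommutativeMonoid.Sum +-commutativeMonoid using (sum; sum-permute; ∑-distrib-+; sum-replicate; sum-cong-≗; sum-init-last; sum-replicate-zero)
  open import Algebra.Properties.Semiring.Mult semiring using (×-assoc-*) renaming (_×_ to _·_)
  open import Algebra.Properties.Semiring.Exp semiring using () renaming (_^_ to _^ᶠ_)
  import Algebra.Properties.CommutativeSemiring.Binomial commutativeSemiring as Binomial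
  open ≡-Reasoning

  to : Fin (p ℕ.^ m) → Carrier
  to = Inverse.to enum

  index : Carrier → Fin (p ℕ.^ m)
  index = Inverse.from enum

  to-index : ∀ x → to (index x) ≡ x
  to-index x = Inverse.inverseˡ enum refl

  index-to : ∀ i → index (to i) ≡ i
  index-to i = Inverse.inverseʳ enum refl

  to-injective : ∀ {i j} → to i ≡ to j → i ≡ j
  to-injective {i} {j} eq = trans (sym (index-to i)) (trans (cong index eq) (index-to j))

  index-injective : ∀ {x y} → index x ≡ index y → x ≡ y
  index-injective {x} {y} eq = trans (sym (to-index x)) (trans (cong to eq) (to-index y))

  infix 4 _≟_
  _≟_ : (x y : Carrier) → Dec (x ≡ y)
  _≟_ = via-injection (↔⇒↣ (↔-sym enum)) Finₚ._≟_

  infixl 6 _-_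
  _-_ : Carrier → Carrier → Carrier
  x - y = x + - y

  x-y+y : ∀ x y → x - y + y ≡ x
  x-y+y x y = trans (+-assoc x (- y) y) (trans (cong (x +_) (-‿inverseˡ y)) (+-identityʳ x))

  x+y-y : ∀ x y → x + y - y ≡ x
  x+y-y x y = trans (+-assoc x y (- y)) (trans (cong (x +_) (-‿inverseʳ y)) (+-identityʳ x))

  x-y≡0⇒x≡y : ∀ {x y} → x - y ≡ 0# → x ≡ y
  x-y≡0⇒x≡y {x} {y} eq = trans (sym (x-y+y x y)) (trans (cong (_+ y) eq) (+-identityˡ y))

  x≡y⇒x-y≡0 : ∀ {x y} → x ≡ y → x - y ≡ 0#
  x≡y⇒x-y≡0 {x} refl = -‿inverseʳ x

  *-distribˡ-- : ∀ x y z → x * (y - z) ≡ x * y - x * z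
  *-distribˡ-- x y z = trans (distribˡ x y (- z)) (cong (x * y +_) (sym (-‿distribʳ-* x z)))

  *-distribʳ-- : ∀ x y z → (y - z) * x ≡ y * x - z * x
  *-distribʳ-- x y z = trans (distribʳ x y (- z)) (cong (y * x +_) (sym (-‿distribˡ-* z x)))

  minus-interchange : ∀ a b c d → (a + b) - (c + d) ≡ (a - c) + (b - d)
  minus-interchange a b c d = trans (cong (a + b +_) (sym (-‿+-comm c d))) (+-interchange a b (- c) (- d))

  minus-minus : ∀ a b c d → (a - b) - (c - d) ≡ (d + a) - (c + b)
  minus-minus a b c d = begin
    (a - b) - (c - d)             ≡⟨ cong (a - b +_) (-‿+-comm c (- d)) ⟨
    (a - b) + (- c + - - d)       ≡⟨ cong (λ v → (a - b) + (- c + v)) (-‿involutive d) ⟩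
    (a - b) + (- c + d)           ≡⟨ cong (a - b +_) (+-comm (- c) d) ⟩
    (a - b) + (d - c)             ≡⟨ minus-interchange a d b c ⟨
    (a + d) - (b + c)             ≡⟨ cong₂ _-_ (+-comm a d) (+-comm b c) ⟩
    (d + a) - (c + b)             ∎

  *-cancelˡ-nonZero : ∀ {x y z} → x ≢ 0# → x * y ≡ x * z → y ≡ z
  *-cancelˡ-nonZero {x} {y} {z} x≢0 eq = begin
    y                ≡⟨ inv-cancel y ⟨
    x ⁻¹ * (x * y)   ≡⟨ cong (x ⁻¹ *_) eq ⟩
    x ⁻¹ * (x * z)   ≡⟨ inv-cancel z ⟩
    z                ∎
    where
    inv-cancel : ∀ u → x ⁻¹ * (x * u) ≡ u
    inv-cancel u = begin
      x ⁻¹ * (x * u)  ≡⟨ *-assoc _ x u ⟨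
      x ⁻¹ * x * u    ≡⟨ cong (_* u) (trans (*-comm _ x) (⁻¹-inverse x x≢0)) ⟩
      1# * u          ≡⟨ *-identityˡ u ⟩
      u               ∎

  x*y≡0⇒y≡0 : ∀ {x y} → x ≢ 0# → x * y ≡ 0# → y ≡ 0#
  x*y≡0⇒y≡0 {x} x≢0 eq = *-cancelˡ-nonZero x≢0 (trans eq (sym (zeroʳ x)))

  -- Powers and the prime field

  pow≡^ : ∀ x n → pow x n ≡ x ^ᶠ n
  pow≡^ x zero    = refl
  pow≡^ x (suc n) = cong (x *_) (pow≡^ x n)

  pow-+ : ∀ x a b → pow x (a ℕ.+ b) ≡ pow x a * pow x b
  pow-+ x zero    b = sym (*-identityˡ _)
  pow-+ x (suc a) b = trans (cong (x *_) (pow-+ x a b)) (sym (*-assoc x _ _))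

  pow-* : ∀ x a b → pow x (a ℕ.* b) ≡ pow (pow x b) a
  pow-* x zero    b = refl
  pow-* x (suc a) b = trans (pow-+ x b (a ℕ.* b)) (cong (pow x b *_) (pow-* x a b))

  pow-distrib-* : ∀ x y n → pow (x * y) n ≡ pow x n * pow y n
  pow-distrib-* x y zero    = sym (*-identityˡ 1#)
  pow-distrib-* x y (suc n) = trans (cong (x * y *_) (pow-distrib-* x y n)) (*-interchange x y _ _)

  pow-1# : ∀ n → pow 1# n ≡ 1#
  pow-1# zero    = refl
  pow-1# (suc n) = trans (*-identityˡ _) (pow-1# n)

  pow-0# : ∀ n .{{_ : NonZero n}} → pow 0# n ≡ 0#
  pow-0# (suc n) = zeroˡ _

  pow≡0⇒≡0 : ∀ {x} n → pow x n ≡ 0# → x ≡ 0#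
  pow≡0⇒≡0 {x} zero    eq = contradiction (sym eq) 0≢1
  pow≡0⇒≡0 {x} (suc n) eq with x ≟ 0#
  ... | yes x≡0 = x≡0
  ... | no  x≢0 = pow≡0⇒≡0 n (x*y≡0⇒y≡0 x≢0 eq)

  natMul1≡· : ∀ n → natMul1 n ≡ n · 1#
  natMul1≡· zero    = refl
  natMul1≡· (suc n) = cong (1# +_) (natMul1≡· n)

  natMul1-+ : ∀ a b → natMul1 (a ℕ.+ b) ≡ natMul1 a + natMul1 b
  natMul1-+ zero    b = sym (+-identityˡ _)
  natMul1-+ (suc a) b = trans (cong (1# +_) (natMul1-+ a b)) (sym (+-assoc _ _ _))

  natMul1-* : ∀ a b → natMul1 (a ℕ.* b) ≡ natMul1 a * natMul1 b
  natMul1-* zero    b = sym (zeroˡ _)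
  natMul1-* (suc a) b = begin
    natMul1 (b ℕ.+ a ℕ.* b)               ≡⟨ natMul1-+ b (a ℕ.* b) ⟩
    natMul1 b + natMul1 (a ℕ.* b)         ≡⟨ cong₂ _+_ (sym (*-identityˡ _)) (natMul1-* a b) ⟩
    1# * natMul1 b + natMul1 a * natMul1 b ≡⟨ distribʳ (natMul1 b) 1# (natMul1 a) ⟨
    (1# + natMul1 a) * natMul1 b          ∎

  natMul1-^ : ∀ a n → natMul1 (a ℕ.^ n) ≡ pow (natMul1 a) n
  natMul1-^ a zero    = +-identityʳ 1#
  natMul1-^ a (suc n) = trans (natMul1-* a (a ℕ.^ n)) (cong (natMul1 a *_) (natMul1-^ a n))

  ·≡natMul1* : ∀ n x → n · x ≡ natMul1 n * x
  ·≡natMul1* n x = begin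
    n · x           ≡⟨ cong (n ·_) (*-identityˡ x) ⟨
    n · (1# * x)    ≡⟨ ×-assoc-* n 1# x ⟨
    (n · 1#) * x    ≡⟨ cong (_* x) (natMul1≡· n) ⟨
    natMul1 n * x   ∎

  -- Translation by 1 permutes F, so the sum over F equals itself plus q·1.
  natMul1-q≡0 : natMul1 (p ℕ.^ m) ≡ 0#
  natMul1-q≡0 = +-cancelˡ (sum to) _ _ (begin
    sum to + natMul1 q          ≡⟨ cong (sum to +_) (trans (natMul1≡· q) (sym (sum-replicate q))) ⟩
    sum to + sum {q} (λ _ → 1#) ≡⟨ ∑-distrib-+ to (λ _ → 1#) ⟨
    sum (λ i → to i + 1#)       ≡⟨ sum-cong-≗ (λ i → to-index (to i + 1#)) ⟨
    sum (λ i → to (index (to i + 1#))) ≡⟨ sum-permute to shift ⟨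
    sum to                      ≡⟨ +-identityʳ _ ⟨
    sum to + 0#                 ∎)
    where
    q = p ℕ.^ m
    shift : Permutation′ q
    shift = permutation (λ i → index (to i + 1#)) (λ i → index (to i - 1#))
      (λ i → trans (cong index (trans (cong (_+ 1#) (to-index _)) (x-y+y _ _))) (index-to i))
      (λ i → trans (cong index (trans (cong (_- 1#) (to-index _)) (x+y-y _ _))) (index-to i))

  -- The m-th power of p·1 is q·1 = 0, and a field has no nonzero nilpotents.
  natMul1-p≡0 : natMul1 p ≡ 0#
  natMul1-p≡0 = pow≡0⇒≡0 m (trans (sym (natMul1-^ p m)) natMul1-q≡0)

  natMul1-suc-* : ∀ n x → x + natMul1 n * x ≡ natMul1 (suc n) * x
  natMul1-suc-* n x = trans (cong (_+ natMul1 n * x) (sym (*-identityˡ x))) (sym (distribʳ x 1# (natMul1 n)))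

  -- Lets closure under addition yield closure under subtraction.
  natMul1-pred-* : ∀ x → natMul1 (ℕ.pred p) * x ≡ - x
  natMul1-pred-* x = +-cancelˡ x _ _ (begin
    x + natMul1 (ℕ.pred p) * x    ≡⟨ natMul1-suc-* (ℕ.pred p) x ⟩
    natMul1 (suc (ℕ.pred p)) * x  ≡⟨ cong (λ n → natMul1 n * x) (ℕₚ.suc-pred p) ⟩
    natMul1 p * x                 ≡⟨ cong (_* x) natMul1-p≡0 ⟩
    0# * x                        ≡⟨ zeroˡ x ⟩
    0#                            ≡⟨ -‿inverseʳ x ⟨
    x - x                         ∎)

  natMul1-multiple : ∀ a c → natMul1 (a ℕ.+ c ℕ.* p) ≡ natMul1 a
  natMul1-multiple a c = begin
    natMul1 (a ℕ.+ c ℕ.* p)              ≡⟨ natMul1-+ a (c ℕ.* p) ⟩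
    natMul1 a + natMul1 (c ℕ.* p)        ≡⟨ cong (natMul1 a +_) (natMul1-* c p) ⟩
    natMul1 a + natMul1 c * natMul1 p    ≡⟨ cong (λ u → natMul1 a + natMul1 c * u) natMul1-p≡0 ⟩
    natMul1 a + natMul1 c * 0#           ≡⟨ cong (natMul1 a +_) (zeroʳ _) ⟩
    natMul1 a + 0#                       ≡⟨ +-identityʳ _ ⟩
    natMul1 a                            ∎

  natMul1-% : ∀ a → natMul1 a ≡ natMul1 (a % p)
  natMul1-% a = trans (cong natMul1 (m≡m%n+[m/n]*n a p)) (natMul1-multiple (a % p) (a / p))

  natMul1-inverse : ∀ {a} → ¬ p ∣ a → ∃ λ e → natMul1 e * natMul1 a ≡ 1#
  natMul1-inverse {a} p∤a with inverse-mod-prime prime p∤a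
  ... | e , c , eq = e , (begin
    natMul1 e * natMul1 a     ≡⟨ natMul1-* e a ⟨
    natMul1 (e ℕ.* a)         ≡⟨ cong natMul1 eq ⟩
    natMul1 (1 ℕ.+ c ℕ.* p)   ≡⟨ natMul1-multiple 1 c ⟩
    1# + 0#                   ≡⟨ +-identityʳ 1# ⟩
    1#                        ∎)

  natMul1-∸ : ∀ {a b} → a ≤ b → natMul1 (b ℕ.∸ a) ≡ natMul1 b - natMul1 a
  natMul1-∸ {a} {b} a≤b = sym (trans (cong (λ u → natMul1 u - natMul1 a) (sym (ℕₚ.m∸n+n≡m a≤b)))
    (trans (cong (_- natMul1 a) (natMul1-+ (b ℕ.∸ a) a)) (x+y-y _ _)))

  p∤b∸a : ∀ {a b} → a < b → b < p → ¬ p ∣ b ℕ.∸ a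
  p∤b∸a {a} {b} a<b b<p p∣d =
    ℕₚ.<⇒≱ (ℕₚ.≤-<-trans (ℕₚ.m∸n≤m b a) b<p) (∣⇒≤ {{ℕ.>-nonZero (ℕₚ.m<n⇒0<n∸m a<b)}} p∣d)

  char∣⇒·≡0 : ∀ {n b} → natMul1 n ≡ 0# → n ∣ b → ∀ x → b · x ≡ 0#
  char∣⇒·≡0 {n} char (divides c refl) x = begin
    (c ℕ.* n) · x                ≡⟨ ·≡natMul1* (c ℕ.* n) x ⟩
    natMul1 (c ℕ.* n) * x        ≡⟨ cong (_* x) (natMul1-* c n) ⟩
    natMul1 c * natMul1 n * x    ≡⟨ cong (λ u → natMul1 c * u * x) char ⟩
    natMul1 c * 0# * x           ≡⟨ cong (_* x) (zeroʳ _) ⟩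
    0# * x                       ≡⟨ zeroˡ x ⟩
    0#                           ∎

  -- The Frobenius map

  -- The exponent is a variable and not the parameter `p`, so that it can be matched as a successor
  -- when the two end terms are split off the binomial sum.
  pow-prime-+ : ∀ n → Prime n → natMul1 n ≡ 0# → ∀ x y → pow (x + y) n ≡ pow x n + pow y n
  pow-prime-+ zero    pr _    x y = contradiction (prime⇒nonZero pr) λ ()
  pow-prime-+ (suc n) pr char x y = begin
    pow (x + y) (suc n)                ≡⟨ pow≡^ (x + y) (suc n) ⟩
    (x + y) ^ᶠ suc n                    ≡⟨ Binomial.theorem (suc n) x y ⟩
    term zero + sum (term ∘ suc)       ≡⟨ cong (term zero +_) (sum-init-last (term ∘ suc)) ⟩
    term zero + (sum (λ i → term (suc (Fin.inject₁ i))) + term (suc (Fin.fromℕ n)))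
      ≡⟨ cong₂ _+_ term-0 (cong₂ _+_ (trans (sum-cong-≗ middle) (sum-replicate-zero n)) last) ⟩
    pow y (suc n) + (0# + pow x (suc n)) ≡⟨ cong (pow y (suc n) +_) (+-identityˡ _) ⟩
    pow y (suc n) + pow x (suc n)      ≡⟨ +-comm _ _ ⟩
    pow x (suc n) + pow y (suc n)      ∎
    where
    term = Binomial.binomialTerm x y (suc n)
    term-0 : term zero ≡ pow y (suc n)
    term-0 = trans (+-identityʳ _) (trans (*-identityˡ _) (sym (pow≡^ y (suc n))))
    middle : ∀ i → term (suc (Fin.inject₁ i)) ≡ 0#
    middle i = char∣⇒·≡0 char
      (prime∣nCk pr (subst (_< n) (sym (Finₚ.toℕ-inject₁ i)) (Finₚ.toℕ<n i))) _
    last : term (suc (Fin.fromℕ n)) ≡ pow x (suc n)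
    last = begin
      term (suc (Fin.fromℕ n))
        ≡⟨ cong (λ k → (suc n C suc k) · (x ^ᶠ suc k * y ^ᶠ (n ℕ.∸ k))) (Finₚ.toℕ-fromℕ n) ⟩
      (suc n C suc n) · (x ^ᶠ suc n * y ^ᶠ (n ℕ.∸ n))
        ≡⟨ cong₂ (λ c k → c · (x ^ᶠ suc n * y ^ᶠ k)) (nCn≡1 (suc n)) (ℕₚ.n∸n≡0 n) ⟩
      1 · (x ^ᶠ suc n * 1#)    ≡⟨ +-identityʳ _ ⟩
      x ^ᶠ suc n * 1#          ≡⟨ *-identityʳ _ ⟩
      x ^ᶠ suc n               ≡⟨ pow≡^ x (suc n) ⟨
      pow x (suc n)           ∎

  natMul1-≢ : ∀ {a b} → a < b → b < p → natMul1 a ≢ natMul1 b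
  natMul1-≢ {a} {b} a<b b<p eq with natMul1-inverse (p∤b∸a a<b b<p)
  ... | e , e*d = 0≢1 (begin
    0#                              ≡⟨ zeroʳ (natMul1 e) ⟨
    natMul1 e * 0#                  ≡⟨ cong (natMul1 e *_) (trans (natMul1-∸ (ℕₚ.<⇒≤ a<b)) (x≡y⇒x-y≡0 (sym eq))) ⟨
    natMul1 e * natMul1 (b ℕ.∸ a)   ≡⟨ e*d ⟩
    1#                              ∎)

  frobenius-+ : ∀ x y → pow (x + y) p ≡ pow x p + pow y p
  frobenius-+ = pow-prime-+ p prime natMul1-p≡0

  frob : ℕ → Carrier → Carrier
  frob n x = pow x (p ℕ.^ n)

  frob-suc : ∀ n x → frob (suc n) x ≡ pow (frob n x) p
  frob-suc n x = pow-* x p (p ℕ.^ n)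

  frob-∘ : ∀ a b x → frob (a ℕ.+ b) x ≡ frob a (frob b x)
  frob-∘ a b x = trans (cong (pow x) (ℕₚ.^-distribˡ-+-* p a b)) (pow-* x (p ℕ.^ a) (p ℕ.^ b))

  frob-0 : ∀ x → frob 0 x ≡ x
  frob-0 = *-identityʳ

  frob-+ : ∀ n x y → frob n (x + y) ≡ frob n x + frob n y
  frob-+ zero    x y = trans (frob-0 _) (sym (cong₂ _+_ (frob-0 x) (frob-0 y)))
  frob-+ (suc n) x y = begin
    frob (suc n) (x + y)                    ≡⟨ frob-suc n (x + y) ⟩
    pow (frob n (x + y)) p                  ≡⟨ cong (λ u → pow u p) (frob-+ n x y) ⟩
    pow (frob n x + frob n y) p             ≡⟨ frobenius-+ _ _ ⟩
    pow (frob n x) p + pow (frob n y) p     ≡⟨ cong₂ _+_ (frob-suc n x) (frob-suc n y) ⟨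
    frob (suc n) x + frob (suc n) y         ∎

  frob-* : ∀ n x y → frob n (x * y) ≡ frob n x * frob n y
  frob-* n x y = pow-distrib-* x y (p ℕ.^ n)

  frob-1# : ∀ n → frob n 1# ≡ 1#
  frob-1# n = pow-1# (p ℕ.^ n)

  -- Additive maps

  Additive : (Carrier → Carrier) → Set
  Additive h = ∀ x y → h (x + y) ≡ h x + h y

  module _ {h : Carrier → Carrier} (h-+ : Additive h) where

    additive-0# : h 0# ≡ 0#
    additive-0# = +-cancelˡ (h 0#) _ _ (begin
      h 0# + h 0#  ≡⟨ h-+ 0# 0# ⟨
      h (0# + 0#)  ≡⟨ cong h (+-identityʳ 0#) ⟩
      h 0#         ≡⟨ +-identityʳ _ ⟨
      h 0# + 0#    ∎)

    additive-- : ∀ x y → h (x - y) ≡ h x - h y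
    additive-- x y = +-cancelʳ (h y) _ _ (begin
      h (x - y) + h y    ≡⟨ h-+ (x - y) y ⟨
      h (x - y + y)      ≡⟨ cong h (x-y+y x y) ⟩
      h x                ≡⟨ x-y+y (h x) (h y) ⟨
      h x - h y + h y    ∎)

    additive-natMul1 : ∀ n x → h (natMul1 n * x) ≡ natMul1 n * h x
    additive-natMul1 zero    x = trans (cong h (zeroˡ x)) (trans additive-0# (sym (zeroˡ _)))
    additive-natMul1 (suc n) x = begin
      h ((1# + natMul1 n) * x)      ≡⟨ cong h (distribʳ x 1# _) ⟩
      h (1# * x + natMul1 n * x)    ≡⟨ h-+ _ _ ⟩
      h (1# * x) + h (natMul1 n * x) ≡⟨ cong₂ _+_ (trans (cong h (*-identityˡ x)) (sym (*-identityˡ _))) (additive-natMul1 n x) ⟩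
      1# * h x + natMul1 n * h x    ≡⟨ distribʳ (h x) 1# _ ⟨
      (1# + natMul1 n) * h x        ∎

  -- Polynomials

  eval : ∀ {n} → Vec Carrier n → Carrier → Carrier
  eval []       x = 0#
  eval (c ∷ cs) x = c + x * eval cs x

  -- The leading coefficient 1 is not stored.
  evalMonic : ∀ {n} → Vec Carrier n → Carrier → Carrier
  evalMonic []       x = 1#
  evalMonic (c ∷ cs) x = c + x * evalMonic cs x

  evalMonic≡ : ∀ {n} (cs : Vec Carrier n) x → evalMonic cs x ≡ eval cs x + pow x n
  evalMonic≡ []       x = sym (+-identityˡ 1#)
  evalMonic≡ {suc n} (c ∷ cs) x = begin
    c + x * evalMonic cs x              ≡⟨ cong (λ u → c + x * u) (evalMonic≡ cs x) ⟩
    c + x * (eval cs x + pow x n)       ≡⟨ cong (c +_) (distribˡ x _ _) ⟩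
    c + (x * eval cs x + x * pow x n)   ≡⟨ +-assoc c _ _ ⟨
    c + x * eval cs x + x * pow x n     ∎

  x*a-r*b : ∀ x r a b q → a ≡ b + (x - r) * q → x * a ≡ r * b + (x - r) * (b + x * q)
  x*a-r*b x r a b q a≡ = begin
    x * a                                      ≡⟨ cong (x *_) a≡ ⟩
    x * (b + (x - r) * q)                      ≡⟨ distribˡ x b _ ⟩
    x * b + x * ((x - r) * q)                  ≡⟨ cong₂ _+_ (cong (_* b) x≡) (*-swap x (x - r) q) ⟩
    (r + (x - r)) * b + (x - r) * (x * q)      ≡⟨ cong (_+ (x - r) * (x * q)) (distribʳ b r _) ⟩
    r * b + (x - r) * b + (x - r) * (x * q)    ≡⟨ +-assoc (r * b) _ _ ⟩
    r * b + ((x - r) * b + (x - r) * (x * q))  ≡⟨ cong (r * b +_) (distribˡ (x - r) b _) ⟨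
    r * b + (x - r) * (b + x * q)              ∎
    where
    x≡ : x ≡ r + (x - r)
    x≡ = trans (sym (x-y+y x r)) (+-comm (x - r) r)

  -- Horner's scheme: the coefficients of the quotient by X - r are the values at r of the tails of
  -- the polynomial.
  divide : ∀ {n} (cs : Vec Carrier (suc n)) r → ∃ λ (qs : Vec Carrier n) →
           ∀ x → evalMonic cs x ≡ evalMonic cs r + (x - r) * evalMonic qs x
  divide (c ∷ []) r = [] , λ x → trans (cong (c +_) (begin
      x * 1#                    ≡⟨ *-identityʳ x ⟩
      x                         ≡⟨ x-y+y x r ⟨
      x - r + r                 ≡⟨ +-comm _ r ⟩
      r + (x - r)               ≡⟨ cong₂ _+_ (*-identityʳ r) (*-identityʳ (x - r)) ⟨
      r * 1# + (x - r) * 1#     ∎)) (sym (+-assoc c _ _))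
  divide (c ∷ cs@(_ ∷ _)) r with divide cs r
  ... | qs , eq = evalMonic cs r ∷ qs , λ x →
    trans (cong (c +_) (x*a-r*b x r _ _ _ (eq x))) (sym (+-assoc c _ _))

  -- The quotient of a monic polynomial by X - r is monic, so the induction ends at the constant 1,
  -- which has no root, and no leading coefficient has to be tested.
  roots≤degree : ∀ {n} (cs : Vec Carrier n) {N} (r : Fin N → Carrier) →
                 (∀ {i j} → r i ≡ r j → i ≡ j) → (∀ i → evalMonic cs (r i) ≡ 0#) → N ≤ n
  roots≤degree cs {zero}  r inj root = z≤n
  roots≤degree [] {suc N} r inj root = contradiction (sym (root zero)) 0≢1
  roots≤degree cs@(_ ∷ _) {suc N} r inj root with divide cs (r zero)
  ... | qs , eq = s≤s (roots≤degree qs (r ∘ suc) (Finₚ.suc-injective ∘ inj) root′)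
    where
    root′ : ∀ i → evalMonic qs (r (suc i)) ≡ 0#
    root′ i = x*y≡0⇒y≡0 (λ d≡0 → contradiction (inj (x-y≡0⇒x≡y d≡0)) λ ()) (begin
      rest                           ≡⟨ +-identityˡ rest ⟨
      0# + rest                      ≡⟨ cong (_+ rest) (root zero) ⟨
      evalMonic cs (r zero) + rest   ≡⟨ eq (r (suc i)) ⟨
      evalMonic cs (r (suc i))       ≡⟨ root (suc i) ⟩
      0#                             ∎)
      where rest = (r (suc i) - r zero) * evalMonic qs (r (suc i))

  Polynomial< : ℕ → (Carrier → Carrier) → Set
  Polynomial< n f = ∃ λ (cs : Vec Carrier n) → ∀ x → f x ≡ eval cs x

  zero-poly : ∀ n → Polynomial< n (λ _ → 0#)
  zero-poly zero    = [] , λ _ → refl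
  zero-poly (suc n) with zero-poly n
  ... | cs , eq = 0# ∷ cs , λ x → sym (trans (cong (λ u → 0# + x * u) (sym (eq x)))
                                        (trans (+-identityˡ _) (zeroʳ x)))

  monomial-poly : ∀ {n k} c → k < n → Polynomial< n (λ x → c * pow x k)
  monomial-poly {suc n} {zero} c _ with zero-poly n
  ... | cs , eq = c ∷ cs , λ x → trans (*-identityʳ c)
    (sym (trans (cong (λ u → c + x * u) (sym (eq x))) (trans (cong (c +_) (zeroʳ x)) (+-identityʳ c))))
  monomial-poly {suc n} {suc k} c (s≤s k<n) with monomial-poly c k<n
  ... | cs , eq = 0# ∷ cs , λ x → trans (*-swap c x _)
    (trans (cong (x *_) (eq x)) (sym (+-identityˡ _)))

  +-poly : ∀ {n f g} → Polynomial< n f → Polynomial< n g → Polynomial< n (λ x → f x + g x)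
  +-poly (cs , f≡) (ds , g≡) = zipWith _+_ cs ds , λ x → trans (cong₂ _+_ (f≡ x) (g≡ x)) (eval-+ cs ds x)
    where
    eval-+ : ∀ {n} (cs ds : Vec Carrier n) x → eval cs x + eval ds x ≡ eval (zipWith _+_ cs ds) x
    eval-+ []       []       x = +-identityʳ 0#
    eval-+ (c ∷ cs) (d ∷ ds) x = trans (+-interchange c _ d _)
      (cong (c + d +_) (trans (sym (distribˡ x _ _)) (cong (x *_) (eval-+ cs ds x))))

  -- Linearised polynomials

  lin : ℕ → (ℕ → Carrier) → Carrier → Carrier
  lin zero    d x = 0#
  lin (suc n) d x = d n * frob n x + lin n d x

  -- The two sides may use different points, so that a factor y^(p^j) of the coefficients can be
  -- absorbed into the argument.
  lin-cong : ∀ n {a b} x y → (∀ j → j < n → a j * frob j x ≡ b j * frob j y) → lin n a x ≡ lin n b y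
  lin-cong zero    x y eq = refl
  lin-cong (suc n) x y eq = cong₂ _+_ (eq n ℕₚ.≤-refl) (lin-cong n x y (λ j j<n → eq j (ℕₚ.m≤n⇒m≤1+n j<n)))

  lin-additive : ∀ n d → Additive (lin n d)
  lin-additive zero    d x y = sym (+-identityʳ 0#)
  lin-additive (suc n) d x y = begin
    d n * frob n (x + y) + lin n d (x + y)
      ≡⟨ cong₂ _+_ (trans (cong (d n *_) (frob-+ n x y)) (distribˡ (d n) _ _)) (lin-additive n d x y) ⟩
    (d n * frob n x + d n * frob n y) + (lin n d x + lin n d y) ≡⟨ +-interchange _ _ _ _ ⟩
    lin (suc n) d x + lin (suc n) d y ∎

  lin-- : ∀ n a b x → lin n (λ j → a j - b j) x ≡ lin n a x - lin n b x
  lin-- zero    a b x = sym (-‿inverseʳ 0#)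
  lin-- (suc n) a b x = begin
    (a n - b n) * frob n x + lin n (λ j → a j - b j) x ≡⟨ cong₂ _+_ (*-distribʳ-- _ (a n) (b n)) (lin-- n a b x) ⟩
    (a n * frob n x - b n * frob n x) + (lin n a x - lin n b x) ≡⟨ minus-interchange _ _ _ _ ⟨
    lin (suc n) a x - lin (suc n) b x ∎

  lin-map : ∀ n {h : Carrier → Carrier} → Additive h → ∀ a b x y →
            (∀ j → j < n → h (a j * frob j x) ≡ b j * frob j y) → h (lin n a x) ≡ lin n b y
  lin-map zero    h-+ a b x y eq = additive-0# h-+
  lin-map (suc n) h-+ a b x y eq = trans (h-+ _ _) (cong₂ _+_ (eq n ℕₚ.≤-refl)
    (lin-map n h-+ a b x y (λ j j<n → eq j (ℕₚ.m≤n⇒m≤1+n j<n))))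

  lin-* : ∀ n c d x → c * lin n d x ≡ lin n (λ j → c * d j) x
  lin-* n c d x = lin-map n (distribˡ c) d _ x x (λ j _ → sym (*-assoc c (d j) _))

  lin-poly : ∀ n d {N} → (∀ j → j < n → p ℕ.^ j < N) → Polynomial< N (lin n d)
  lin-poly zero    d bound = zero-poly _
  lin-poly (suc n) d bound = +-poly (monomial-poly (d n) (bound n ℕₚ.≤-refl))
    (lin-poly n d (λ j j<n → bound j (ℕₚ.m≤n⇒m≤1+n j<n)))

  1<p : 1 < p
  1<p = ℕ.nonTrivial⇒n>1 p {{prime⇒nonTrivial prime}}

  p^-mono-< : ∀ {i j} → i < j → p ℕ.^ i < p ℕ.^ j
  p^-mono-< = ℕₚ.^-monoʳ-< p 1<p

  -- A nonzero top coefficient could be scaled to 1, giving a monic polynomial of degree p^n < q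
  -- that vanishes at all q elements.
  lin≡0⇒≡0 : ∀ n d → n ≤ m → (∀ x → lin n d x ≡ 0#) → ∀ j → j < n → d j ≡ 0#
  lin≡0⇒≡0 (suc n) d n<m eq j j<1+n with d n ≟ 0#
  ... | no dn≢0 = contradiction q≤p^n (ℕₚ.<⇒≱ (p^-mono-< n<m))
    where
    lower = lin-poly n (λ j → d n ⁻¹ * d j) (λ j → p^-mono-<)
    q≤p^n : p ℕ.^ m ≤ p ℕ.^ n
    q≤p^n = roots≤degree (proj₁ lower) to to-injective
      λ i → let x = to i in begin
        evalMonic (proj₁ lower) x                ≡⟨ evalMonic≡ (proj₁ lower) x ⟩
        eval (proj₁ lower) x + frob n x          ≡⟨ cong (_+ frob n x) (trans (lin-* n _ d x) (proj₂ lower x)) ⟨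
        d n ⁻¹ * lin n d x + frob n x            ≡⟨ cong (d n ⁻¹ * lin n d x +_) (trans (sym (*-identityˡ _)) (trans (cong (_* frob n x) (trans (sym (⁻¹-inverse (d n) dn≢0)) (*-comm _ _))) (*-assoc _ _ _))) ⟩
        d n ⁻¹ * lin n d x + d n ⁻¹ * (d n * frob n x) ≡⟨ distribˡ (d n ⁻¹) _ _ ⟨
        d n ⁻¹ * (lin n d x + d n * frob n x)    ≡⟨ cong (d n ⁻¹ *_) (trans (+-comm _ _) (eq x)) ⟩
        d n ⁻¹ * 0#                              ≡⟨ zeroʳ _ ⟩
        0#                                       ∎
  ... | yes dn≡0 with ℕₚ.m≤n⇒m<n∨m≡n j<1+n
  ...   | inj₂ refl      = dn≡0
  ...   | inj₁ (s≤s j<n) = lin≡0⇒≡0 n d (ℕₚ.<⇒≤ n<m) eq′ j j<n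
    where
    eq′ : ∀ x → lin n d x ≡ 0#
    eq′ x = begin
      lin n d x                       ≡⟨ +-identityˡ _ ⟨
      0# + lin n d x                  ≡⟨ cong (_+ lin n d x) (trans (cong (_* frob n x) dn≡0) (zeroˡ _)) ⟨
      d n * frob n x + lin n d x      ≡⟨ eq x ⟩
      0#                              ∎

  lin-injective : ∀ a b → (∀ x → lin m a x ≡ lin m b x) → ∀ j → j < m → a j ≡ b j
  lin-injective a b eq j j<m = x-y≡0⇒x≡y (lin≡0⇒≡0 m (λ j → a j - b j) ℕₚ.≤-refl
    (λ x → trans (lin-- m a b x) (x≡y⇒x-y≡0 (eq x))) j j<m)

  -- Additive maps are linearised polynomials

  Image : ∀ {N} → (Fin N → Carrier) → Carrier → Set
  Image f x = ∃ λ i → f i ≡ x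

  -- Injectivity of element on Fin (p ^ n) encodes the linear independence of the n generators.
  record Subspace (n : ℕ) : Set where
    field
      element    : Fin (p ℕ.^ n) → Carrier
      injective  : ∀ {i j} → element i ≡ element j → i ≡ j
      0∈         : Image element 0#
      +-closed   : ∀ {x y} → Image element x → Image element y → Image element (x + y)
      generator  : Fin n → Carrier
      generates  : ∀ {h} → Additive h → (∀ i → h (generator i) ≡ 0#) → ∀ i → h (element i) ≡ 0#

    natMul1-closed : ∀ n {x} → Image element x → Image element (natMul1 n * x)
    natMul1-closed zero    {x} x∈ = subst (Image element) (sym (zeroˡ x)) 0∈
    natMul1-closed (suc n) {x} x∈ = subst (Image element) (natMul1-suc-* n x) (+-closed x∈ (natMul1-closed n x∈))

    minus-closed : ∀ {x y} → Image element x → Image element y → Image element (x - y)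
    minus-closed {x} {y} x∈ y∈ =
      subst (λ v → Image element (x + v)) (natMul1-pred-* y) (+-closed x∈ (natMul1-closed (ℕ.pred p) y∈))

  zero-subspace : Subspace 0
  zero-subspace = record
    { element   = λ _ → 0#
    ; injective = λ { {zero} {zero} _ → refl }
    ; 0∈        = zero , refl
    ; +-closed  = λ { (_ , refl) (_ , refl) → zero , sym (+-identityʳ 0#) }
    ; generator = λ ()
    ; generates = λ h-+ _ _ → additive-0# h-+
    }

  module _ {n} (V : Subspace n) (u : Carrier) (u∉ : ¬ Image (Subspace.element V) u) where
    open Subspace V

    combination : Fin p → Fin (p ℕ.^ n) → Carrier
    combination a b = natMul1 (toℕ a) * u + element b

    extended : Fin (p ℕ.^ suc n) → Carrier
    extended i = let a , b = Fin.remQuot {p} (p ℕ.^ n) i in combination a b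

    extended-combine : ∀ a b → extended (Fin.combine a b) ≡ combination a b
    extended-combine a b = cong (λ (a , b) → combination a b) (Finₚ.remQuot-combine a b)

    -- Equality would put (a′ - a) u in the subspace, and then u as well, since a′ - a is invertible
    -- modulo p.
    combination≢ : ∀ {a a′ b b′} → toℕ a < toℕ a′ → combination a b ≢ combination a′ b′
    combination≢ {a} {a′} {b} {b′} a<a′ eq = u∉ (subst (Image element) e*d*u≡u (natMul1-closed e d*u∈))
      where
      d = toℕ a′ ℕ.∸ toℕ a
      inverse = natMul1-inverse (p∤b∸a a<a′ (Finₚ.toℕ<n a′))
      e = proj₁ inverse
      e*d*u≡u : natMul1 e * (natMul1 d * u) ≡ u
      e*d*u≡u = trans (sym (*-assoc _ _ u)) (trans (cong (_* u) (proj₂ inverse)) (*-identityˡ u))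
      d*u≡ : element b - element b′ ≡ natMul1 d * u
      d*u≡ = x-y≡0⇒x≡y (begin
        element b - element b′ - natMul1 d * u
          ≡⟨ cong (λ v → element b - element b′ - v * u) (natMul1-∸ (ℕₚ.<⇒≤ a<a′)) ⟩
        element b - element b′ - (natMul1 (toℕ a′) - natMul1 (toℕ a)) * u
          ≡⟨ cong (λ v → element b - element b′ - v) (*-distribʳ-- u _ _) ⟩
        element b - element b′ - (natMul1 (toℕ a′) * u - natMul1 (toℕ a) * u)
          ≡⟨ minus-minus _ _ _ _ ⟩
        combination a b - combination a′ b′
          ≡⟨ x≡y⇒x-y≡0 eq ⟩
        0# ∎)
      d*u∈ : Image element (natMul1 d * u)
      d*u∈ = subst (Image element) d*u≡ (minus-closed (b , refl) (b′ , refl))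

    combination-injective : ∀ {a a′ b b′} → combination a b ≡ combination a′ b′ → (a , b) ≡ (a′ , b′)
    combination-injective {a} {a′} {b} {b′} eq with ℕₚ.<-cmp (toℕ a) (toℕ a′)
    ... | tri< a<a′ _ _ = contradiction eq (combination≢ a<a′)
    ... | tri> _ _ a>a′ = contradiction (sym eq) (combination≢ a>a′)
    ... | tri≈ _ a≡a′ _ with Finₚ.toℕ-injective a≡a′
    ...   | refl = cong (a ,_) (injective (+-cancelˡ _ _ _ eq))

    extend : Subspace (suc n)
    extend = record
      { element   = extended
      ; injective = λ {i} {j} eq → trans (sym (Finₚ.combine-remQuot {p} (p ℕ.^ n) i))
          (trans (cong (λ (a , b) → Fin.combine a b) (combination-injective eq)) (Finₚ.combine-remQuot {p} (p ℕ.^ n) j))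
      ; 0∈        = extended-0∈
      ; +-closed  = extended-+
      ; generator = λ { zero → u ; (suc i) → generator i }
      ; generates = λ {h} h-+ h≡0 i → let a , b = Fin.remQuot {p} (p ℕ.^ n) i in begin
          h (natMul1 (toℕ a) * u + element b)       ≡⟨ h-+ _ _ ⟩
          h (natMul1 (toℕ a) * u) + h (element b)   ≡⟨ cong₂ _+_ (additive-natMul1 h-+ (toℕ a) u) (generates h-+ (h≡0 ∘ suc) b) ⟩
          natMul1 (toℕ a) * h u + 0#                ≡⟨ trans (+-identityʳ _) (trans (cong (natMul1 (toℕ a) *_) (h≡0 zero)) (zeroʳ _)) ⟩
          0#                                        ∎
      }
      where
      ∈extended : ∀ c {x} → Image element x → Image extended (natMul1 c * u + x)
      ∈extended c (b , refl) = Fin.combine a b , trans (extended-combine a b)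
          (cong (λ v → v * u + element b) (trans (cong natMul1 (Finₚ.toℕ-fromℕ< (m%n<n c p))) (sym (natMul1-% c))))
        where a = Fin.fromℕ< (m%n<n c p)
      extended-0∈ : Image extended 0#
      extended-0∈ = subst (Image extended) (trans (+-identityʳ _) (zeroˡ u)) (∈extended 0 0∈)
      extended-+ : ∀ {x y} → Image extended x → Image extended y → Image extended (x + y)
      extended-+ (i , refl) (j , refl) = subst (Image extended) eq
          (∈extended (toℕ a ℕ.+ toℕ a′) (+-closed (b , refl) (b′ , refl)))
        where
        a = proj₁ (Fin.remQuot {p} (p ℕ.^ n) i)
        b = proj₂ (Fin.remQuot {p} (p ℕ.^ n) i)
        a′ = proj₁ (Fin.remQuot {p} (p ℕ.^ n) j)
        b′ = proj₂ (Fin.remQuot {p} (p ℕ.^ n) j)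
        eq : natMul1 (toℕ a ℕ.+ toℕ a′) * u + (element b + element b′) ≡ combination a b + combination a′ b′
        eq = trans (cong (_+ (element b + element b′)) (trans (cong (_* u) (natMul1-+ (toℕ a) (toℕ a′))) (distribʳ u _ _)))
               (+-interchange _ _ _ _)

  subspace-bound : ∀ {n} → Subspace n → n ≤ m
  subspace-bound {n} V with n ℕₚ.≤? m
  ... | yes n≤m = n≤m
  ... | no  n≰m = contradiction (Finₚ.injective⇒≤ {f = index ∘ element} (injective ∘ index-injective))
                    (ℕₚ.<⇒≱ (p^-mono-< (ℕₚ.≰⇒> n≰m)))
    where open Subspace V

  -- Spanning is tested on additive maps instead of by linear combinations; this is the form in
  -- which a linear relation is carried from the family to all of F.
  Spanning : ∀ {n} → (Fin n → Carrier) → Set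
  Spanning w = ∀ {h} → Additive h → (∀ i → h (w i) ≡ 0#) → ∀ x → h x ≡ 0#

  spanning-family : ∃₂ λ n (w : Fin n → Carrier) → n ≤ m × Spanning w
  -- The fuel k and the dimension n keep the sum m + 1; running out of fuel would give a subspace of
  -- dimension m + 1, with more than q elements.
  spanning-family = grow (suc m) 0 (ℕₚ.+-identityʳ (suc m)) zero-subspace
    where
    grow : ∀ k n → k ℕ.+ n ≡ suc m → Subspace n → ∃₂ λ n (w : Fin n → Carrier) → n ≤ m × Spanning w
    grow zero    n refl V = contradiction (subspace-bound V) ℕₚ.1+n≰n
    grow (suc k) n k+n V with Finₚ.all? (λ i → Finₚ.any? (λ j → Subspace.element V j ≟ to i))
    ... | yes full = n , generator , subspace-bound V , λ {h} h-+ h≡0 x →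
          let j , eq = full (index x) in
          trans (cong h (sym (trans eq (to-index x)))) (generates h-+ h≡0 j)
      where open Subspace V
    ... | no ¬full = let i , ∉ = Finₚ.¬∀⟶∃¬ _ _ (λ i → Finₚ.any? (λ j → Subspace.element V j ≟ to i)) ¬full in
          grow k (suc n) (trans (ℕₚ.+-suc k n) k+n) (extend V (to i) ∉)

  private
    q : ℕ
    q = p ℕ.^ m

  funToFin-cong : ∀ {k N} {f g : Fin k → Fin N} → (∀ i → f i ≡ g i) → Fin.funToFin f ≡ Fin.funToFin g
  funToFin-cong {zero}  f≗g = refl
  funToFin-cong {suc k} f≗g = cong₂ Fin.combine (f≗g zero) (funToFin-cong (f≗g ∘ suc))

  -- `lin m` reads only the indices below m, so for m coefficients the default 0 is never reached.
  pad : ∀ {n} → (Fin n → Carrier) → ℕ → Carrier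
  pad {n} v j with j ℕₚ.<? n
  ... | yes j<n = v (Fin.fromℕ< j<n)
  ... | no  _   = 0#

  pad-toℕ : ∀ {n} (v : Fin n → Carrier) i → pad v (toℕ i) ≡ v i
  pad-toℕ {n} v i with toℕ i ℕₚ.<? n
  ... | yes i<n = cong v (Finₚ.fromℕ<-toℕ i i<n)
  ... | no  i≮n = contradiction (Finₚ.toℕ<n i) i≮n

  additive⇒lin : ∀ {h} → Additive h → ∃ λ a → ∀ x → h x ≡ lin m a x
  additive⇒lin {h} h-+ = dependence spanning-family
    where
    -- A number below q^(m+1) codes m + 1 field elements: the coefficient of h, then those of the m
    -- Frobenius powers.
    lead : Fin (q ℕ.^ suc m) → Carrier
    lead i = to (Fin.finToFun {q} {suc m} i zero)
    coeff : Fin (q ℕ.^ suc m) → ℕ → Carrier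
    coeff i = pad (λ j → to (Fin.finToFun {q} {suc m} i (suc j)))
    value : Fin (q ℕ.^ suc m) → Carrier → Carrier
    value i x = lead i * h x + lin m (coeff i) x

    separated : ∀ {i j} → lead i ≡ lead j → (∀ k → k < m → coeff i k ≡ coeff j k) → i ≡ j
    separated {i} {j} lead≡ coeff≡ = trans (sym (Finₚ.funToFin-finToFin {suc m} {q} i))
      (trans (funToFin-cong agree) (Finₚ.funToFin-finToFin {suc m} {q} j))
      where
      agree : ∀ k → Fin.finToFun {q} {suc m} i k ≡ Fin.finToFun {q} {suc m} j k
      agree zero    = to-injective lead≡
      agree (suc k) = to-injective (trans (sym (pad-toℕ _ k)) (trans (coeff≡ (toℕ k) (Finₚ.toℕ<n k)) (pad-toℕ _ k)))

    -- F^(m+1) cannot inject into F^n, so h and the m Frobenius powers are linearly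
    -- dependent on the spanning family, hence everywhere.
    dependence : (∃₂ λ n (w : Fin n → Carrier) → n ≤ m × Spanning w) → ∃ λ a → ∀ x → h x ≡ lin m a x
    dependence (n , w , n≤m , span)
      with Finₚ.pigeonhole (ℕₚ.^-monoʳ-< q (p^-mono-< m≥1) (s≤s n≤m))
             (λ i → Fin.funToFin (λ k → index (value i (w k))))
    ... | i , j , i<j , same = solve-for-h (e ≟ 0#)
      where
      e = lead i - lead j
      d : ℕ → Carrier
      d k = coeff i k - coeff j k
      relation : ∀ x → e * h x + lin m d x ≡ value i x - value j x
      relation x = begin
        e * h x + lin m d x   ≡⟨ cong₂ _+_ (*-distribʳ-- (h x) _ _) (lin-- m _ _ x) ⟩
        (lead i * h x - lead j * h x) + (lin m (coeff i) x - lin m (coeff j) x) ≡⟨ minus-interchange _ _ _ _ ⟨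
        value i x - value j x ∎
      relation-+ : Additive (λ x → e * h x + lin m d x)
      relation-+ x y = trans (cong₂ _+_ (trans (cong (e *_) (h-+ x y)) (distribˡ e _ _)) (lin-additive m d x y))
                         (+-interchange _ _ _ _)
      on-w : ∀ k → value i (w k) ≡ value j (w k)
      on-w k = index-injective (trans (sym (Finₚ.finToFun-funToFin _ k))
        (trans (cong (λ c → Fin.finToFun c k) same) (Finₚ.finToFun-funToFin _ k)))
      vanishes : ∀ x → e * h x + lin m d x ≡ 0#
      vanishes = span relation-+ (λ k → trans (relation (w k)) (x≡y⇒x-y≡0 (on-w k)))
      solve-for-h : Dec (e ≡ 0#) → ∃ λ a → ∀ x → h x ≡ lin m a x
      -- Without h the relation is a linearised polynomial vanishing on F, so all its coefficients
      -- are zero and the two coded tuples coincide.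
      solve-for-h (yes e≡0) = contradiction (separated (x-y≡0⇒x≡y e≡0) (λ k k<m →
          x-y≡0⇒x≡y (lin≡0⇒≡0 m d ℕₚ.≤-refl lin≡0 k k<m))) (Finₚ.<⇒≢ i<j)
        where
        lin≡0 : ∀ x → lin m d x ≡ 0#
        lin≡0 x = trans (sym (+-identityˡ _)) (trans (cong (_+ lin m d x) (sym (trans (cong (_* h x) e≡0) (zeroˡ _)))) (vanishes x))
      solve-for-h (no e≢0) = (λ k → - (e ⁻¹) * d k) , λ x → *-cancelˡ-nonZero e≢0 (+-cancelʳ (lin m d x) _ _ (begin
        e * h x + lin m d x                            ≡⟨ vanishes x ⟩
        0#                                             ≡⟨ -‿inverseˡ (lin m d x) ⟨
        - lin m d x + lin m d x                        ≡⟨ cong (_+ lin m d x) (begin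
          - lin m d x                     ≡⟨ cong -_ (*-identityˡ _) ⟨
          - (1# * lin m d x)              ≡⟨ cong (λ v → - (v * lin m d x)) (⁻¹-inverse e e≢0) ⟨
          - (e * e ⁻¹ * lin m d x)        ≡⟨ -‿distribˡ-* _ _ ⟩
          - (e * e ⁻¹) * lin m d x        ≡⟨ cong (_* lin m d x) (-‿distribʳ-* e _) ⟩
          e * - (e ⁻¹) * lin m d x        ≡⟨ *-assoc e _ _ ⟩
          e * (- (e ⁻¹) * lin m d x)      ≡⟨ cong (e *_) (lin-* m _ d x) ⟩
          e * lin m (λ k → - (e ⁻¹) * d k) x ∎) ⟩
        e * lin m (λ k → - (e ⁻¹) * d k) x + lin m d x ∎))

  -- Automorphisms are powers of the Frobenius

  δ : ℕ → ℕ → Carrier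
  δ i j with i ℕₚ.≟ j
  ... | yes _ = 1#
  ... | no  _ = 0#

  δ-refl : ∀ i → δ i i ≡ 1#
  δ-refl i with i ℕₚ.≟ i
  ... | yes _   = refl
  ... | no  i≢i = contradiction refl i≢i

  δ-≢ : ∀ {i j} → i ≢ j → δ i j ≡ 0#
  δ-≢ {i} {j} i≢j with i ℕₚ.≟ j
  ... | yes i≡j = contradiction i≡j i≢j
  ... | no  _   = refl

  lin-δ-≥ : ∀ n i x → n ≤ i → lin n (δ i) x ≡ 0#
  lin-δ-≥ zero    i x n≤i = refl
  lin-δ-≥ (suc n) i x n<i = begin
    δ i n * frob n x + lin n (δ i) x ≡⟨ cong₂ _+_ (cong (_* frob n x) (δ-≢ (ℕₚ.>⇒≢ n<i))) (lin-δ-≥ n i x (ℕₚ.<⇒≤ n<i)) ⟩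
    0# * frob n x + 0#               ≡⟨ trans (+-identityʳ _) (zeroˡ _) ⟩
    0#                               ∎

  lin-δ : ∀ n i x → i < n → lin n (δ i) x ≡ frob i x
  lin-δ (suc n) i x i<1+n with ℕₚ.m≤n⇒m<n∨m≡n i<1+n
  ... | inj₂ refl = begin
    δ n n * frob n x + lin n (δ n) x ≡⟨ cong₂ _+_ (cong (_* frob n x) (δ-refl n)) (lin-δ-≥ n n x ℕₚ.≤-refl) ⟩
    1# * frob n x + 0#               ≡⟨ trans (+-identityʳ _) (*-identityˡ _) ⟩
    frob n x                         ∎
  ... | inj₁ (s≤s i<n) = begin
    δ i n * frob n x + lin n (δ i) x ≡⟨ cong₂ _+_ (cong (_* frob n x) (δ-≢ (ℕₚ.<⇒≢ i<n))) (lin-δ n i x i<n) ⟩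
    0# * frob n x + frob i x         ≡⟨ trans (cong (_+ frob i x) (zeroˡ _)) (+-identityˡ _) ⟩
    frob i x                         ∎

  frob-distinct : ∀ {i j} → i < m → j < m → (∀ x → frob i x ≡ frob j x) → i ≡ j
  frob-distinct {i} {j} i<m j<m eq with i ℕₚ.≟ j
  ... | yes i≡j = i≡j
  ... | no  i≢j = contradiction (begin
    0#      ≡⟨ δ-≢ i≢j ⟨
    δ i j   ≡⟨ lin-injective (δ i) (δ j) (λ x → trans (lin-δ m i x i<m) (trans (eq x) (sym (lin-δ m j x j<m)))) j j<m ⟩
    δ j j   ≡⟨ δ-refl j ⟩
    1#      ∎) 0≢1

  frob-injective : ∀ n {x y} → frob n x ≡ frob n y → x ≡ y
  frob-injective n {x} {y} eq = x-y≡0⇒x≡y (pow≡0⇒≡0 (p ℕ.^ n)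
    (trans (additive-- (frob-+ n) x y) (x≡y⇒x-y≡0 eq)))

  -- Comparing the coefficients of h (x y) = h x h y as polynomials in x leaves a single
  -- Frobenius power.
  endomorphism⇒frob : ∀ {h} → Additive h → (∀ x y → h (x * y) ≡ h x * h y) → h 1# ≡ 1# →
                      ∃ λ j → j < m × (∀ x → h x ≡ frob j x)
  endomorphism⇒frob {h} h-+ h-* h-1 with additive⇒lin h-+
  ... | a , h≡ with Finₚ.any? (λ (j : Fin m) → ¬? (a (toℕ j) ≟ 0#))
  ...   | yes (j , aj≢0) = toℕ j , Finₚ.toℕ<n j , λ y → sym (*-cancelˡ-nonZero aj≢0
            (trans (coefficients y (toℕ j) (Finₚ.toℕ<n j)) (*-comm (h y) _)))
    where
    coefficients : ∀ y j → j < m → a j * frob j y ≡ h y * a j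
    coefficients y = lin-injective (λ j → a j * frob j y) (λ j → h y * a j) (λ x → begin
      lin m (λ j → a j * frob j y) x  ≡⟨ lin-cong m x (y * x) (λ j _ → trans (*-assoc (a j) _ _) (cong (a j *_) (sym (frob-* j y x)))) ⟩
      lin m a (y * x)                 ≡⟨ h≡ (y * x) ⟨
      h (y * x)                       ≡⟨ h-* y x ⟩
      h y * h x                       ≡⟨ cong (h y *_) (h≡ x) ⟩
      h y * lin m a x                 ≡⟨ lin-* m (h y) a x ⟩
      lin m (λ j → h y * a j) x       ∎)
  ...   | no ¬any = contradiction (begin
      0#             ≡⟨ zeroˡ (lin m a 1#) ⟨
      0# * lin m a 1# ≡⟨ lin-* m 0# a 1# ⟩
      lin m (λ j → 0# * a j) 1# ≡⟨ lin-cong m 1# 1# (λ j j<m → cong (_* frob j 1#) (trans (zeroˡ _) (sym (vanish j j<m)))) ⟩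
      lin m a 1#     ≡⟨ h≡ 1# ⟨
      h 1#           ≡⟨ h-1 ⟩
      1#             ∎) 0≢1
    where
    vanish : ∀ j → j < m → a j ≡ 0#
    vanish j j<m with a j ≟ 0#
    ... | yes aj≡0 = aj≡0
    ... | no  aj≢0 = contradiction
      (Fin.fromℕ< j<m , subst (λ k → a k ≢ 0#) (sym (Finₚ.toℕ-fromℕ< j<m)) aj≢0) ¬any

  -- The m-th Frobenius power is itself an endomorphism, hence equals the j-th for some j < m. For j
  -- > 0, cancelling would make the (m - j)-th power the identity, against the distinctness of the
  -- powers below m.
  frob-m : ∀ x → frob m x ≡ x
  frob-m with endomorphism⇒frob (frob-+ m) (frob-* m) (frob-1# m)
  ... | zero  , _   , eq = λ x → trans (eq x) (frob-0 x)
  ... | suc j , j<m , eq = contradiction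
        (frob-distinct (ℕₚ.∸-monoʳ-< {o = 0} (s≤s z≤n) (ℕₚ.<⇒≤ j<m)) m≥1
          (λ x → trans (period x) (sym (frob-0 x))))
        (ℕₚ.>⇒≢ (ℕₚ.m<n⇒0<n∸m j<m))
    where
    period : ∀ x → frob (m ℕ.∸ suc j) x ≡ x
    period x = frob-injective (suc j) (begin
      frob (suc j) (frob (m ℕ.∸ suc j) x)  ≡⟨ frob-∘ (suc j) (m ℕ.∸ suc j) x ⟨
      frob (suc j ℕ.+ (m ℕ.∸ suc j)) x     ≡⟨ cong (λ n → frob n x) (ℕₚ.m+[n∸m]≡n (ℕₚ.<⇒≤ j<m)) ⟩
      frob m x                             ≡⟨ eq x ⟩
      frob (suc j) x                       ∎)

  frob-multiple : ∀ a c x → frob (a ℕ.+ c ℕ.* m) x ≡ frob a x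
  frob-multiple a c x = trans (frob-∘ a (c ℕ.* m) x) (cong (frob a) (multiple c))
    where
    multiple : ∀ c → frob (c ℕ.* m) x ≡ x
    multiple zero    = frob-0 x
    multiple (suc c) = trans (frob-∘ m (c ℕ.* m) x) (trans (frob-m _) (multiple c))

  frob≡id⇒m∣ : ∀ a → (∀ x → frob a x ≡ x) → m ∣ a
  frob≡id⇒m∣ a eq = m%n≡0⇒n∣m a m (frob-distinct (m%n<n a m) m≥1 (λ x → begin
    frob (a % m) x                     ≡⟨ frob-multiple (a % m) (a / m) x ⟨
    frob (a % m ℕ.+ a / m ℕ.* m) x     ≡⟨ cong (λ n → frob n x) (m≡m%n+[m/n]*n a m) ⟨
    frob a x                           ≡⟨ eq x ⟩
    x                                  ≡⟨ frob-0 x ⟨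
    frob 0 x                           ∎))
    where instance
      m≢0 : NonZero m
      m≢0 = ℕ.>-nonZero m≥1

  aut⇒frob : ∀ σ → ∃ λ i → ∀ x → fun σ x ≡ frob i x
  aut⇒frob σ = let i , _ , eq = endomorphism⇒frob (hom-+ σ) (hom-* σ) (hom-1 σ) in i , eq

  iter-frob : ∀ σ {i} → (∀ x → fun σ x ≡ frob i x) → ∀ n x → iter σ n x ≡ frob (n ℕ.* i) x
  iter-frob σ     eq zero    x = sym (frob-0 x)
  iter-frob σ {i} eq (suc n) x = trans (eq _) (trans (cong (frob i) (iter-frob σ eq n x)) (sym (frob-∘ i (n ℕ.* i) x)))

  -- Aut(F) is cyclic, so its elements of order dividing p are the powers of any g of order p.
  PowId-p⇒power : ∀ g → HasOrder g p → ∀ σ → PowId σ p → ∃ λ k → ∀ x → fun σ x ≡ iter g k x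
  PowId-p⇒power g (_ , g^p , minimal) σ σ^p = compare (aut⇒frob g) (aut⇒frob σ)
    where
    compare : (∃ λ j → ∀ x → fun g x ≡ frob j x) → (∃ λ i → ∀ x → fun σ x ≡ frob i x) →
              ∃ λ k → ∀ x → fun σ x ≡ iter g k x
    compare (j , g≡) (i , σ≡) =
      let k , c , k*j≡ = p-torsion-cyclic {i = i} {j} prime (m∣p* g {j} g≡ g^p) m∤j (m∣p* σ {i} σ≡ σ^p) in
      k , λ x → sym (begin
        iter g k x               ≡⟨ iter-frob g g≡ k x ⟩
        frob (k ℕ.* j) x         ≡⟨ cong (λ n → frob n x) k*j≡ ⟩
        frob (i ℕ.+ c ℕ.* m) x   ≡⟨ frob-multiple i c x ⟩
        frob i x                 ≡⟨ σ≡ x ⟨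
        fun σ x                  ∎)
      where
      m∣p* : ∀ τ {i} → (∀ x → fun τ x ≡ frob i x) → PowId τ p → m ∣ p ℕ.* i
      m∣p* τ {i} τ≡ τ^p = frob≡id⇒m∣ (p ℕ.* i) (λ x → trans (sym (iter-frob τ τ≡ p x)) (τ^p x))
      m∤j : ¬ m ∣ j
      m∤j (divides c refl) = minimal 1 ℕₚ.≤-refl 1<p (λ x → trans (g≡ x) (trans (frob-multiple 0 c x) (frob-0 x)))

  -- Trace representation

  fermat : ∀ n → pow (natMul1 n) p ≡ natMul1 n
  fermat zero    = pow-0# p
  fermat (suc n) = trans (frobenius-+ 1# (natMul1 n)) (cong₂ _+_ (pow-1# p) (fermat n))

  aut-natMul1 : ∀ σ n → fun σ (natMul1 n) ≡ natMul1 n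
  aut-natMul1 σ zero    = additive-0# (hom-+ σ)
  aut-natMul1 σ (suc n) = trans (hom-+ σ 1# _) (cong₂ _+_ (hom-1 σ) (aut-natMul1 σ n))

  aut-pow : ∀ σ x n → fun σ (pow x n) ≡ pow (fun σ x) n
  aut-pow σ x zero    = hom-1 σ
  aut-pow σ x (suc n) = trans (hom-* σ x _) (cong (fun σ x *_) (aut-pow σ x n))

  aut-injective : ∀ σ {x y} → fun σ x ≡ fun σ y → x ≡ y
  aut-injective σ {x} {y} eq = trans (sym (inv-l σ x)) (trans (cong (inv σ) eq) (inv-l σ y))

  iter-∘ : ∀ σ a b x → iter σ (a ℕ.+ b) x ≡ iter σ a (iter σ b x)
  iter-∘ σ zero    b x = refl
  iter-∘ σ (suc a) b x = cong (fun σ) (iter-∘ σ a b x)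

  iter-additive : ∀ σ n → Additive (iter σ n)
  iter-additive σ zero    x y = refl
  iter-additive σ (suc n) x y = trans (cong (fun σ) (iter-additive σ n x y)) (hom-+ σ _ _)

  iter-injective : ∀ σ n {x y} → iter σ n x ≡ iter σ n y → x ≡ y
  iter-injective σ zero    eq = eq
  iter-injective σ (suc n) eq = iter-injective σ n (aut-injective σ eq)

  iter-surjective : ∀ σ n y → ∃ λ x → iter σ n x ≡ y
  iter-surjective σ zero    y = y , refl
  iter-surjective σ (suc n) y with iter-surjective σ n (inv σ y)
  ... | x , eq = x , trans (cong (fun σ) eq) (inv-r σ y)

  -- An automorphism commutes with the Frobenius, so in terms of y = σ(x) the two composites are
  -- linearised polynomials with coefficients σ(a_j) and a_j.
  lin-fixed : ∀ {h : Carrier → Carrier} {a} → (∀ x → h x ≡ lin m a x) → ∀ σ → (∀ x → fun σ (h x) ≡ h (fun σ x)) → fun σ (a 0) ≡ a 0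
  lin-fixed {h} {a} h≡ σ comm = lin-injective (fun σ ∘ a) a (λ y → begin
    lin m (fun σ ∘ a) y                  ≡⟨ cong (lin m (fun σ ∘ a)) (inv-r σ y) ⟨
    lin m (fun σ ∘ a) (fun σ (inv σ y))  ≡⟨ lin-map m (hom-+ σ) a _ _ _ (λ j _ → trans (hom-* σ _ _) (cong (fun σ (a j) *_) (aut-pow σ _ (p ℕ.^ j)))) ⟨
    fun σ (lin m a (inv σ y))            ≡⟨ cong (fun σ) (h≡ _) ⟨
    fun σ (h (inv σ y))                  ≡⟨ comm _ ⟩
    h (fun σ (inv σ y))                  ≡⟨ cong h (inv-r σ y) ⟩
    h y                                  ≡⟨ h≡ y ⟩
    lin m a y                            ∎) 0 m≥1

  -- A linearised polynomial with values in the prime field satisfies h ^ p = h; comparing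
  -- coefficients gives a (j + 1) = a j ^ p.
  module _ {h : Carrier → Carrier} {a : ℕ → Carrier} (h≡ : ∀ x → h x ≡ lin m a x) (h^p : ∀ x → pow (h x) p ≡ h x) where
    private
      -- The coefficients of the p-th power of Σ a_j x^(p^j): raising to the p-th power shifts them
      -- by one, and x^q = x wraps the top one round to index 0.
      b : ℕ → Carrier
      b zero    = pow (a (ℕ.pred m)) p
      b (suc j) = pow (a j) p

    -- The shift before the wrap-around: the p-th power has no term of index 0, so `b 0 * x` is
    -- added to match a sum that starts there.
    lin-pow : ∀ n x → lin (suc n) b x ≡ pow (lin n a x) p + b 0 * x
    lin-pow zero x = begin
      b 0 * frob 0 x + 0#      ≡⟨ +-comm _ 0# ⟩
      0# + b 0 * frob 0 x      ≡⟨ cong₂ _+_ (sym (pow-0# p)) (cong (b 0 *_) (frob-0 x)) ⟩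
      pow 0# p + b 0 * x       ∎
    lin-pow (suc n) x = begin
      b (suc n) * frob (suc n) x + lin (suc n) b x
        ≡⟨ cong₂ _+_ (trans (cong (b (suc n) *_) (frob-suc n x)) (sym (pow-distrib-* (a n) _ p))) (lin-pow n x) ⟩
      pow (a n * frob n x) p + (pow (lin n a x) p + b 0 * x)  ≡⟨ +-assoc _ _ _ ⟨
      pow (a n * frob n x) p + pow (lin n a x) p + b 0 * x    ≡⟨ cong (_+ b 0 * x) (frobenius-+ _ _) ⟨
      pow (a n * frob n x + lin n a x) p + b 0 * x            ∎

    b-m : b m ≡ b 0
    b-m = cong b (sym (ℕₚ.suc-pred m {{ℕ.>-nonZero m≥1}}))

    lin-a≡lin-b : ∀ x → lin m a x ≡ lin m b x
    lin-a≡lin-b x = +-cancelʳ (b 0 * x) _ _ (begin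
      lin m a x + b 0 * x            ≡⟨ cong (_+ b 0 * x) (trans (cong (λ u → pow u p) (sym (h≡ x))) (trans (h^p x) (h≡ x))) ⟨
      pow (lin m a x) p + b 0 * x    ≡⟨ lin-pow m x ⟨
      b m * frob m x + lin m b x     ≡⟨ cong (_+ lin m b x) (cong₂ _*_ b-m (frob-m x)) ⟩
      b 0 * x + lin m b x            ≡⟨ +-comm _ _ ⟩
      lin m b x + b 0 * x            ∎)

    a≡frob : ∀ j → j < m → a j ≡ frob j (a 0)
    a≡frob zero    _     = sym (frob-0 (a 0))
    a≡frob (suc j) j+1<m = begin
      a (suc j)            ≡⟨ lin-injective a b lin-a≡lin-b (suc j) j+1<m ⟩
      pow (a j) p          ≡⟨ cong (λ u → pow u p) (a≡frob j (ℕₚ.<⇒≤ j+1<m)) ⟩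
      pow (frob j (a 0)) p ≡⟨ frob-suc j (a 0) ⟨
      frob (suc j) (a 0)   ∎

    lin≡trace : ∀ x → h x ≡ trace (a 0 * x)
    lin≡trace x = begin
      h x                                ≡⟨ h≡ x ⟩
      lin m a x                          ≡⟨ lin-cong m x (a 0 * x) (λ j j<m → trans (cong (_* frob j x) (a≡frob j j<m)) (trans (sym (frob-* j (a 0) x)) (sym (*-identityˡ _)))) ⟩
      lin m (λ _ → 1#) (a 0 * x)         ≡⟨ traceSum≡lin m (a 0 * x) ⟨
      traceSum F m (a 0 * x)             ≡⟨ trace≡traceSum F (a 0 * x) ⟨
      trace (a 0 * x)                    ∎
      where
      traceSum≡lin : ∀ n y → traceSum F n y ≡ lin n (λ _ → 1#) y
      traceSum≡lin zero    y = refl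
      traceSum≡lin (suc n) y = cong₂ _+_ (sym (*-identityˡ _)) (traceSum≡lin n y)

  additive⇒trace : ∀ {h : Carrier → Carrier} → Additive h → (∀ x → pow (h x) p ≡ h x) →
                   ∃ λ μ → (∀ x → h x ≡ trace (μ * x)) × (∀ σ → (∀ x → fun σ (h x) ≡ h (fun σ x)) → fun σ μ ≡ μ)
  additive⇒trace h-+ h^p =
    let a , h≡ = additive⇒lin h-+ in a 0 , lin≡trace {a = a} h≡ h^p , lin-fixed {a = a} h≡

  -- Twisted homomorphisms into the powers of g

  module _ (g : Aut) (g-order : HasOrder g p) where
    private
      g^p : PowId g p
      g^p = proj₁ (proj₂ g-order)

    iter-multiple : ∀ a c x → iter g (a ℕ.+ c ℕ.* p) x ≡ iter g a x
    iter-multiple a c x = trans (iter-∘ g a (c ℕ.* p) x) (cong (iter g a) (multiple c))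
      where
      multiple : ∀ c → iter g (c ℕ.* p) x ≡ x
      multiple zero    = refl
      multiple (suc c) = trans (iter-∘ g p (c ℕ.* p) x) (trans (g^p _) (multiple c))

    iter-% : ∀ a x → iter g a x ≡ iter g (a % p) x
    iter-% a x = trans (cong (λ n → iter g n x) (m≡m%n+[m/n]*n a p)) (iter-multiple (a % p) (a / p) x)

    natMul1-<-injective : ∀ {a b} → a < p → b < p → natMul1 a ≡ natMul1 b → a ≡ b
    natMul1-<-injective {a} {b} a<p b<p eq with ℕₚ.<-cmp a b
    ... | tri≈ _ a≡b _ = a≡b
    ... | tri< a<b _ _ = contradiction eq (natMul1-≢ a<b b<p)
    ... | tri> _ _ b<a = contradiction (sym eq) (natMul1-≢ b<a a<p)

    iter-≢ : ∀ {a b} → a < b → b < p → ¬ (∀ x → iter g a x ≡ iter g b x)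
    iter-≢ {a} {b} a<b b<p eq = proj₂ (proj₂ g-order) (b ℕ.∸ a) (ℕₚ.m<n⇒0<n∸m a<b)
      (ℕₚ.≤-<-trans (ℕₚ.m∸n≤m b a) b<p) (λ x → iter-injective g a (begin
        iter g a (iter g (b ℕ.∸ a) x)    ≡⟨ iter-∘ g a (b ℕ.∸ a) x ⟨
        iter g (a ℕ.+ (b ℕ.∸ a)) x       ≡⟨ cong (λ n → iter g n x) (ℕₚ.m+[n∸m]≡n (ℕₚ.<⇒≤ a<b)) ⟩
        iter g b x                       ≡⟨ eq x ⟨
        iter g a x                       ∎))

    iter-<-injective : ∀ {a b} → a < p → b < p → (∀ x → iter g a x ≡ iter g b x) → a ≡ b
    iter-<-injective {a} {b} a<p b<p eq with ℕₚ.<-cmp a b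
    ... | tri≈ _ a≡b _ = a≡b
    ... | tri< a<b _ _ = contradiction eq (iter-≢ a<b b<p)
    ... | tri> _ _ b<a = contradiction (λ x → sym (eq x)) (iter-≢ b<a a<p)

    -- g and the element 1 of the additive group both have order p, so each identifies exactly the
    -- exponents congruent modulo p. This carries the law of f over to a law in the prime field.
    iter≡⇒natMul1≡ : ∀ a b → (∀ x → iter g a x ≡ iter g b x) → natMul1 a ≡ natMul1 b
    iter≡⇒natMul1≡ a b eq = begin
      natMul1 a         ≡⟨ natMul1-% a ⟩
      natMul1 (a % p)   ≡⟨ cong natMul1 (iter-<-injective (m%n<n a p) (m%n<n b p) (λ x → trans (sym (iter-% a x)) (trans (eq x) (iter-% b x)))) ⟩
      natMul1 (b % p)   ≡⟨ natMul1-% b ⟨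
      natMul1 b         ∎

    natMul1≡⇒iter≡ : ∀ a b → natMul1 a ≡ natMul1 b → ∀ x → iter g a x ≡ iter g b x
    natMul1≡⇒iter≡ a b eq x = begin
      iter g a x        ≡⟨ iter-% a x ⟩
      iter g (a % p) x  ≡⟨ cong (λ n → iter g n x) (natMul1-<-injective (m%n<n a p) (m%n<n b p) (trans (sym (natMul1-% a)) (trans eq (natMul1-% b)))) ⟩
      iter g (b % p) x  ≡⟨ iter-% b x ⟨
      iter g b x        ∎

    -- The exponent function, its zero set and its invariance under g

    module _ (κ : Carrier → ℕ)
             (κ-law : ∀ x y z → iter g (κ (iter g (κ y) x + y)) z ≡ iter g (κ y) (iter g (κ x) z)) where

      k : Carrier → Carrier
      k x = natMul1 (κ x)

      K : Carrier → Set
      K x = k x ≡ 0#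

      k-law : ∀ x y → k (iter g (κ y) x + y) ≡ k y + k x
      k-law x y = trans (iter≡⇒natMul1≡ (κ (iter g (κ y) x + y)) (κ y ℕ.+ κ x) (λ z → trans (κ-law x y z) (sym (iter-∘ g (κ y) (κ x) z)))) (natMul1-+ (κ y) (κ x))

      k-0 : K 0#
      k-0 = +-cancelˡ (k 0#) _ _ (begin
        k 0# + k 0#                  ≡⟨ k-law 0# 0# ⟨
        k (iter g (κ 0#) 0# + 0#)    ≡⟨ cong k (trans (+-identityʳ _) (additive-0# (iter-additive g (κ 0#)))) ⟩
        k 0#                         ≡⟨ +-identityʳ _ ⟨
        k 0# + 0#                    ∎)

      k-+K : ∀ x {y} → K y → k (x + y) ≡ k x
      k-+K x {y} y∈K = begin
        k (x + y)                   ≡⟨ cong (λ v → k (v + y)) (natMul1≡⇒iter≡ (κ y) 0 y∈K x) ⟨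
        k (iter g (κ y) x + y)      ≡⟨ k-law x y ⟩
        k y + k x                   ≡⟨ cong (_+ k x) y∈K ⟩
        0# + k x                    ≡⟨ +-identityˡ _ ⟩
        k x                         ∎

      -- x - y is y⁻¹ ∘ x in the group law x ∘ y = x ^ θ(y) + y as soon as θ x = θ y.
      K-of-≡ : ∀ {x y} → k x ≡ k y → K (x - y)
      K-of-≡ {x} {y} eq with iter-surjective g (κ y) (- y)
      ... | y⁻ , y⁻≡ = begin
        k (x - y)                    ≡⟨ cong k (+-comm x (- y)) ⟩
        k (- y + x)                  ≡⟨ cong (λ v → k (v + x)) (trans (natMul1≡⇒iter≡ (κ x) (κ y) eq y⁻) y⁻≡) ⟨
        k (iter g (κ x) y⁻ + x)      ≡⟨ k-law y⁻ x ⟩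
        k x + k y⁻                   ≡⟨ cong (_+ k y⁻) eq ⟩
        k y + k y⁻                   ≡⟨ k-law y⁻ y ⟨
        k (iter g (κ y) y⁻ + y)      ≡⟨ cong (λ v → k (v + y)) y⁻≡ ⟩
        k (- y + y)                  ≡⟨ cong k (-‿inverseˡ y) ⟩
        k 0#                         ≡⟨ k-0 ⟩
        0#                           ∎

      K-+ : ∀ {x y} → K x → K y → K (x + y)
      K-+ {x} x∈K y∈K = trans (k-+K x y∈K) x∈K

      K-- : ∀ {x y} → K x → K y → K (x - y)
      K-- x∈K y∈K = K-of-≡ (trans x∈K (sym y∈K))

      K-natMul1 : ∀ n {x} → K x → K (natMul1 n * x)
      K-natMul1 zero    {x} x∈K = trans (cong k (zeroˡ x)) k-0
      K-natMul1 (suc n) {x} x∈K = subst K (natMul1-suc-* n x) (K-+ x∈K (K-natMul1 n x∈K))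

      -- Normality of the kernel: f(y) z + y has the same k as y, so their difference f(y) z lies in
      -- K.
      K-iter-κ : ∀ y {z} → K z → K (iter g (κ y) z)
      K-iter-κ y {z} z∈K = subst K (x+y-y _ y) (K-of-≡ (trans (k-law z y)
        (trans (cong (k y +_) z∈K) (+-identityʳ _))))

      residue : Carrier → Fin p
      residue x = Fin.fromℕ< (m%n<n (κ x) p)

      residue≡⇒k≡ : ∀ {x y} → residue x ≡ residue y → k x ≡ k y
      residue≡⇒k≡ {x} {y} eq = trans (natMul1-% (κ x)) (trans
        (cong natMul1 (Finₚ.fromℕ<-injective _ _ (m%n<n (κ x) p) (m%n<n (κ y) p) eq)) (sym (natMul1-% (κ y))))

      module _ (x₀ : Carrier) (x₀∉K : ¬ K x₀) where

        p∤κx₀ : ¬ p ∣ κ x₀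
        p∤κx₀ (divides c eq) = x₀∉K (trans (cong natMul1 eq) (natMul1-multiple 0 c))

        -- As κ(x₀) is invertible modulo p, g is a power of f(x₀), which preserves K.
        K-g : ∀ {z} → K z → K (fun g z)
        K-g {z} z∈K with inverse-mod-prime prime p∤κx₀
        ... | e , c , eq = subst K (trans (cong (λ n → iter g n z) eq) (iter-multiple 1 c z)) (powers e)
          where
          powers : ∀ e → K (iter g (e ℕ.* κ x₀) z)
          powers zero    = z∈K
          powers (suc e) = subst K (sym (iter-∘ g (κ x₀) (e ℕ.* κ x₀) z)) (K-iter-κ x₀ (powers e))

        -- k separates the multiples n x₀ with n < p and takes at most p values.
        multiple-mod-K : ∀ x → ∃ λ n → K (x - natMul1 n * x₀)
        multiple-mod-K x with Finₚ.pigeonhole (ℕₚ.n<1+n p) (λ i → residue (point i))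
          where
          point : Fin (suc p) → Carrier
          point zero    = x
          point (suc i) = natMul1 (toℕ i) * x₀
        ... | zero  , suc j , _ , eq = toℕ j , K-of-≡ (residue≡⇒k≡ eq)
        -- A collision between two multiples would put (j - i) x₀ in K, and with it x₀, since j - i
        -- is invertible modulo p.
        ... | suc i , suc j , s≤s i<j , eq with natMul1-inverse (p∤b∸a i<j (Finₚ.toℕ<n j))
        ...   | e , e*d = contradiction (subst K e*d*x₀ (K-natMul1 e (K-of-≡ (sym (residue≡⇒k≡ eq))))) x₀∉K
          where
          e*d*x₀ : natMul1 e * (natMul1 (toℕ j) * x₀ - natMul1 (toℕ i) * x₀) ≡ x₀
          e*d*x₀ = begin
            natMul1 e * (natMul1 (toℕ j) * x₀ - natMul1 (toℕ i) * x₀)  ≡⟨ cong (natMul1 e *_) (*-distribʳ-- x₀ _ _) ⟨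
            natMul1 e * ((natMul1 (toℕ j) - natMul1 (toℕ i)) * x₀)     ≡⟨ cong (λ v → natMul1 e * (v * x₀)) (natMul1-∸ (ℕₚ.<⇒≤ i<j)) ⟨
            natMul1 e * (natMul1 (toℕ j ℕ.∸ toℕ i) * x₀)               ≡⟨ *-assoc _ _ x₀ ⟨
            natMul1 e * natMul1 (toℕ j ℕ.∸ toℕ i) * x₀                 ≡⟨ cong (_* x₀) e*d ⟩
            1# * x₀                                                    ≡⟨ *-identityˡ x₀ ⟩
            x₀                                                         ∎

        -- g acts on the line F/K by some scalar n, and n = n ^ p = 1 because g ^ p = 1.
        gx₀-x₀∈K : K (fun g x₀ - x₀)
        gx₀-x₀∈K with multiple-mod-K (fun g x₀)
        -- The equality n = 1 is bypassed: g x₀ and x₀ are both congruent to n x₀ modulo K, the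
        -- latter by taking i = p in `powers`.
        ... | n , gx₀-nx₀∈K = subst K (telescope _ _ _) (K-- gx₀-nx₀∈K x₀-nx₀∈K)
          where
          telescope : ∀ a b c → (a - b) - (c - b) ≡ a - c
          telescope a b c = begin
            (a - b) - (c - b)   ≡⟨ minus-minus a b c b ⟩
            (b + a) - (c + b)   ≡⟨ cong (λ v → v - (c + b)) (+-comm b a) ⟩
            (a + b) - (c + b)   ≡⟨ minus-interchange a b c b ⟩
            (a - c) + (b - b)   ≡⟨ cong (a - c +_) (-‿inverseʳ b) ⟩
            a - c + 0#          ≡⟨ +-identityʳ _ ⟩
            a - c               ∎
          powers : ∀ i → K (iter g i x₀ - natMul1 (n ℕ.^ i) * x₀)
          powers zero    = trans (cong k (x≡y⇒x-y≡0 (sym (trans (cong (_* x₀) (+-identityʳ 1#)) (*-identityˡ x₀))))) k-0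
          powers (suc i) = subst K eq (K-+ (K-g (powers i)) (K-natMul1 (n ℕ.^ i) gx₀-nx₀∈K))
            where
            N = natMul1 (n ℕ.^ i)
            eq : fun g (iter g i x₀ - N * x₀) + N * (fun g x₀ - natMul1 n * x₀)
                 ≡ fun g (iter g i x₀) - natMul1 (n ℕ.^ suc i) * x₀
            eq = begin
              fun g (iter g i x₀ - N * x₀) + N * (fun g x₀ - natMul1 n * x₀)
                ≡⟨ cong₂ _+_ (trans (additive-- (hom-+ g) _ _) (cong (λ v → fun g (iter g i x₀) - v) (additive-natMul1 (hom-+ g) (n ℕ.^ i) x₀))) (*-distribˡ-- N _ _) ⟩
              (fun g (iter g i x₀) - N * fun g x₀) + (N * fun g x₀ - N * (natMul1 n * x₀))
                ≡⟨ trans (sym (+-assoc _ _ _)) (cong (_- N * (natMul1 n * x₀)) (x-y+y _ _)) ⟩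
              fun g (iter g i x₀) - N * (natMul1 n * x₀)
                ≡⟨ cong (λ v → fun g (iter g i x₀) - v) (trans (sym (*-assoc N _ x₀)) (cong (_* x₀) (trans (*-comm N _) (sym (natMul1-* n (n ℕ.^ i)))))) ⟩
              fun g (iter g i x₀) - natMul1 (n ℕ.^ suc i) * x₀ ∎
          x₀-nx₀∈K : K (x₀ - natMul1 n * x₀)
          x₀-nx₀∈K = subst K (cong₂ (λ u v → u - v * x₀) (g^p x₀) (trans (natMul1-^ n p) (fermat n))) (powers p)

        -- Write x = n x₀ + r with r in K: g - 1 sends r into K because K is stable under g, and it
        -- sends x₀ into K.
        gx-x∈K : ∀ x → K (fun g x - x)
        gx-x∈K x with multiple-mod-K x
        ... | n , r∈K = subst K eq (K-+ (K-- (K-g r∈K) r∈K) (K-natMul1 n gx₀-x₀∈K))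
          where
          N = natMul1 n
          r = x - N * x₀
          eq : (fun g r - r) + N * (fun g x₀ - x₀) ≡ fun g x - x
          eq = begin
            (fun g r - r) + N * (fun g x₀ - x₀)            ≡⟨ cong (fun g r - r +_) (*-distribˡ-- N _ _) ⟩
            (fun g r - r) + (N * fun g x₀ - N * x₀)        ≡⟨ minus-interchange _ _ _ _ ⟨
            (fun g r + N * fun g x₀) - (r + N * x₀)        ≡⟨ cong₂ _-_ (trans (cong (fun g r +_) (sym (additive-natMul1 (hom-+ g) n x₀))) (trans (sym (hom-+ g _ _)) (cong (fun g) (x-y+y x _)))) (x-y+y x _) ⟩
            fun g x - x                                    ∎

      k-g : ∀ x → k (fun g x) ≡ k x
      k-g x with Finₚ.all? (λ i → k (to i) ≟ 0#)
      ... | yes all = trans (everywhere (fun g x)) (sym (everywhere x))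
        where
        everywhere : ∀ y → K y
        everywhere y = subst K (to-index y) (all (index y))
      ... | no ¬all with Finₚ.¬∀⟶∃¬ _ _ (λ i → k (to i) ≟ 0#) ¬all
      ...   | i , x₀∉K = begin
        k (fun g x)              ≡⟨ cong k (trans (+-comm x _) (x-y+y (fun g x) x)) ⟨
        k (x + (fun g x - x))    ≡⟨ k-+K x (gx-x∈K (to i) x₀∉K x) ⟩
        k x                      ∎

      k-iter : ∀ n x → k (iter g n x) ≡ k x
      k-iter zero    x = refl
      k-iter (suc n) x = trans (k-g _) (k-iter n x)

      -- Write x = f(y) x′: the law gives k(x + y) = k(y) + k(x′), and invariance under g replaces
      -- x′ by x.
      k-additive : Additive k
      k-additive x y with iter-surjective g (κ y) x
      ... | x′ , refl = begin
        k (iter g (κ y) x′ + y)          ≡⟨ k-law x′ y ⟩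
        k y + k x′                       ≡⟨ +-comm _ _ ⟩
        k x′ + k y                       ≡⟨ cong (_+ k y) (k-iter (κ y) x′) ⟨
        k (iter g (κ y) x′) + k y        ∎

    module _ (f : Carrier → Aut)
             (f-law : ∀ x y z → fun (f (fun (f y) x + y)) z ≡ fun (f y) (fun (f x) z)) where

      twisted-hom⇒trace : (κ : Carrier → ℕ) → (∀ x z → fun (f x) z ≡ iter g (κ x) z) →
        ∃[ μ ] (fun g μ ≡ μ × (∀ x → IsPowByPrimeField (f x) g (trace (μ * x))))
      twisted-hom⇒trace κ f≡ =
        let μ , k≡ , fixed = additive⇒trace (k-additive κ κ-law) (λ x → fermat (κ x))
        -- g fixes the prime field and k is invariant under g, so g ∘ k = k = k ∘ g.
        in μ , fixed g (λ x → trans (aut-natMul1 g (κ x)) (sym (k-g κ κ-law x))) , λ x → κ x , k≡ x , f≡ x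
        where
        κ-law : ∀ x y z → iter g (κ (iter g (κ y) x + y)) z ≡ iter g (κ y) (iter g (κ x) z)
        κ-law x y z = begin
          iter g (κ (iter g (κ y) x + y)) z  ≡⟨ cong (λ v → iter g (κ (v + y)) z) (f≡ y x) ⟨
          iter g (κ (fun (f y) x + y)) z     ≡⟨ f≡ _ z ⟨
          fun (f (fun (f y) x + y)) z        ≡⟨ f-law x y z ⟩
          fun (f y) (fun (f x) z)            ≡⟨ trans (f≡ y _) (cong (iter g (κ y)) (f≡ x z)) ⟩
          iter g (κ y) (iter g (κ x) z)      ∎

      exponent-p⇒trace : (∀ x → PowId (f x) p) →
        ∃[ μ ] (fun g μ ≡ μ × (∀ x → IsPowByPrimeField (f x) g (trace (μ * x))))
      exponent-p⇒trace f^p = twisted-hom⇒trace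
        (λ x → proj₁ (PowId-p⇒power g g-order (f x) (f^p x)))
        (λ x → proj₂ (PowId-p⇒power g g-order (f x) (f^p x)))

  -- The multiplication of G

  PowId-1⇒PowId : ∀ {σ} → PowId σ 1 → ∀ n → PowId σ n
  PowId-1⇒PowId         σ≡id zero    x = refl
  PowId-1⇒PowId {σ = σ} σ≡id (suc n) x = trans (σ≡id (iter σ n x)) (PowId-1⇒PowId {σ = σ} σ≡id n x)

  -- Both p^0 and p^1 divide p.
  exponent⇒PowId-p : ∀ {f : Carrier → Aut} → ∃[ r ] (IsExponent f (p ℕ.^ r) × r ≤ 1) → ∀ x → PowId (f x) p
  exponent⇒PowId-p {f} (zero  , (_ , f^1 , _) , _) x = PowId-1⇒PowId {σ = f x} (f^1 x) p
  exponent⇒PowId-p {f} (suc zero , (_ , f^p , _) , _) x = subst (PowId (f x)) (ℕₚ.*-identityʳ p) (f^p x)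
  exponent⇒PowId-p (suc (suc _) , _ , s≤s ())

  module _ (T : Tfun) (θ : Θfun) (closed : Closed T θ) where

    private
      0+ : ∀ {u v w} → u ≡ 0# → v ≡ w → u + v ≡ w
      0+ u≡0 v≡w = trans (cong₂ _+_ u≡0 v≡w) (+-identityˡ _)

      θ-cong : ∀ {a a′ b b′ c c′} → a ≡ a′ → b ≡ b′ → c ≡ c′ → ∀ z → fun (θ a b c) z ≡ fun (θ a′ b′ c′) z
      θ-cong refl refl refl z = refl

      module _ (σ : Aut) where
        σ0* : ∀ u → fun σ 0# * u ≡ 0#
        σ0* u = trans (cong (_* u) (additive-0# (hom-+ σ))) (zeroˡ u)

        σ1* : ∀ u → fun σ 1# * u ≡ u
        σ1* u = trans (cong (_* u) (hom-1 σ)) (*-identityˡ u)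

    -- The last row of E(a, b, c, t) is (a, b, c, 1), so the last row of a product reveals its
    -- parameters. There the value of T in the right factor is multiplied by the entry c = 0 of the
    -- left one.
    ψGA-law : ∀ x y z → fun (ψGA θ (fun (ψGA θ y) x + y)) z ≡ fun (ψGA θ y) (fun (ψGA θ x) z)
    ψGA-law x y z with closed x 0# 0# y 0# 0#
    ... | a , b , c , product , θ≡ = trans (sym (θ-cong a≡ b≡ c≡ z)) (θ≡ z)
      where
      σ = ψGA θ y
      a≡ : a ≡ fun σ x + y
      a≡ = trans (product (# 3) (# 0)) (cong₂ _+_ (*-identityʳ _) (0+ (σ0* σ _) (0+ (σ0* σ _) (σ1* σ y))))
      b≡ : b ≡ 0#
      b≡ = trans (product (# 3) (# 1)) (0+ (zeroʳ _) (0+ (σ0* σ _) (0+ (σ0* σ _) (σ1* σ 0#))))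
      c≡ : c ≡ 0#
      c≡ = trans (product (# 3) (# 2)) (0+ (zeroʳ _) (0+ (σ0* σ _) (0+ (σ0* σ _) (σ1* σ 0#))))

    ψGB-law : ∀ x y z → fun (ψGB θ (fun (ψGB θ y) x + y)) z ≡ fun (ψGB θ y) (fun (ψGB θ x) z)
    ψGB-law x y z with closed 0# x 0# 0# y 0#
    ... | a , b , c , product , θ≡ = trans (sym (θ-cong a≡ b≡ c≡ z)) (θ≡ z)
      where
      σ = ψGB θ y
      a≡ : a ≡ 0#
      -- The entry σ(x) meets -c of the right factor, which is -0.
      a≡ = trans (product (# 3) (# 0)) (0+ (σ0* σ _) (0+ (trans (cong (fun σ x *_) -0#≈0#) (zeroʳ _)) (0+ (σ0* σ _) (σ1* σ 0#))))
      b≡ : b ≡ fun σ x + y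
      b≡ = trans (product (# 3) (# 1)) (0+ (σ0* σ _) (cong₂ _+_ (*-identityʳ _) (0+ (σ0* σ _) (σ1* σ y))))
      c≡ : c ≡ 0#
      c≡ = trans (product (# 3) (# 2)) (0+ (σ0* σ _) (0+ (zeroʳ _) (0+ (σ0* σ _) (σ1* σ 0#))))

theorem5p5 : (p m : ℕ) (F : FiniteField p m) →
    let open FiniteField F in
    (T : Tfun) (θ : Θfun) → Closed T θ → SomeNontrivial θ →
    (g₂ : Aut) → HasOrder g₂ p →
    ((∃[ rA ] (IsExponent (ψGA θ) (p ^ rA) × rA ≤ 1)) →
    ∃[ μA ] (fun g₂ μA ≡ μA × (∀ x → IsPowByPrimeField (ψGA θ x) g₂ (trace (μA * x)))))
    ×
    ((∃[ rB ] (IsExponent (ψGB θ) (p ^ rB) × rB ≤ 1)) →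
    ∃[ μB ] (fun g₂ μB ≡ μB × (∀ x → IsPowByPrimeField (ψGB θ x) g₂ (trace (μB * x)))))
theorem5p5 p m F T θ closed _ g₂ g₂-order =
    (λ exponent → exponent-p⇒trace F g₂ g₂-order (ψGA θ) (ψGA-law F T θ closed) (exponent⇒PowId-p F exponent))
  , (λ exponent → exponent-p⇒trace F g₂ g₂-order (ψGB θ) (ψGB-law F T θ closed) (exponent⇒PowId-p F exponent))
  where open FiniteField F
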